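{- In the noisy model with parameter $\gamma$, any (possibly randomized) algorithm obtaining an $(n^{3/8}/40)$-approximation for RANK on inputs of size $n$ with probability $2/3$ necessarily has query complexity $\Omega(n\log n/\gamma^2)$.
   Context: RANK on inputs of size $n$: there are $n$ elements $a_1,\dots,a_n$ and another special element $b$; for each $i$ there is an unknown underlying order of the pair $(a_i,b)$ (either $a_i<b$ or $a_i>b$). The algorithm may make (adaptively, and with repetition) noisy comparisons of the form $(a_i,b)$ only. The goal is to output the number of elements of $\{a_1,\dots,a_n\}$ that are less than $b$; an output is a $t$-approximation if it is within additive error $t$ of this number. Noisy model with parameter $\gamma$: each comparison independently returns the correct answer with probability $1/2+\gamma/2$ and the incorrect answer with probability $1/2-\gamma/2$. Query complexity is the total number of comparisons (there is no restriction on the number of adaptive rounds). Asymptotics are as $n\to\infty$. An algorithm obtains a $t$-approximation with probability $2/3$ if on every input its output is a $t$-approximation with probability at least $2/3$ over the comparison outcomes and its own randomness.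
   Formalization: The parameter γ is taken with 0 < γ ≤ γ₀ for an arbitrary γ₀ < 1, and the constant in Ω may depend on γ₀ (not on γ); without this the claim fails, since for γ = 1 comparisons are exact and n queries suffice. -}

module Defs where

open import Data.Bool.Base using (Bool; true; false; if_then_else_)
open import Data.Bool.Properties using () renaming (_≟_ to _≟ᵇ_)
open import Data.Fin.Base using (Fin)
open import Data.Fin.Subset using (Subset; ∣_∣)
open import Data.Integer.Base using (+_)
open import Data.Nat.Base as ℕ using (ℕ; zero; suc)
import Data.Nat.Properties as ℕₚ
open import Data.Product.Base using (Σ; ∃; _×_; _,_)
open import Data.Rational.Base as ℚ using (ℚ; 0ℚ; 1ℚ; ½)
import Data.Rational.Properties as ℚₚ
open import Data.Rational.Solver using (module +-*-Solver)
open import Data.Vec.Base using (lookup)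
open import Relation.Binary.PropositionalEquality using (_≡_; refl; sym; trans; cong; cong₂; subst)
open import Relation.Nullary.Decidable.Core using (Dec; does)

open import Algebra.Definitions.RawSemiring ℚ.+-*-rawSemiring using () renaming (_^_ to _^ℚ_)

ℕtoℚ : ℕ → ℚ
ℕtoℚ n = + n ℚ./ 1

-- The reals are Cauchy sequences of rationals with pointwise operations; x and
-- y represent the same number when x ≤ℝ y and y ≤ℝ x.
IsCauchy : (ℕ → ℚ) → Set
IsCauchy x = ∀ (ε : ℚ) → 0ℚ ℚ.< ε →
  ∃ λ N → ∀ i j → N ℕ.≤ i → N ℕ.≤ j → ℚ.∣ x i ℚ.- x j ∣ ℚ.≤ ε

record ℝ : Set where
  constructor mkℝ
  field
    seq    : ℕ → ℚ
    cauchy : IsCauchy seq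

open ℝ public

infix 4 _≤ℝ_ _<ℝ_

_≤ℝ_ : ℝ → ℝ → Set
x ≤ℝ y = ∀ (ε : ℚ) → 0ℚ ℚ.< ε →
  ∃ λ N → ∀ i → N ℕ.≤ i → seq x i ℚ.≤ seq y i ℚ.+ ε

_<ℝ_ : ℝ → ℝ → Set
x <ℝ y = Σ ℚ λ ε → 0ℚ ℚ.< ε ×
  (∃ λ N → ∀ i → N ℕ.≤ i → seq x i ℚ.+ ε ℚ.≤ seq y i)

private
  module Identities where
    open +-*-Solver

    diff-+ : ∀ a b c d → (a ℚ.+ b) ℚ.- (c ℚ.+ d) ≡ (a ℚ.- c) ℚ.+ (b ℚ.- d)
    diff-+ = solve 4 (λ a b c d → (a :+ b) :- (c :+ d) := (a :- c) :+ (b :- d)) refl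

    diff-neg : ∀ a b → ℚ.- a ℚ.- ℚ.- b ≡ ℚ.- (a ℚ.- b)
    diff-neg = solve 2 (λ a b → (:- a) :- (:- b) := :- (a :- b)) refl

    split : ∀ a b → a ≡ b ℚ.+ (a ℚ.- b)
    split = solve 2 (λ a b → a := b :+ (a :- b)) refl

    diff-* : ∀ a b c d → a ℚ.* b ℚ.- c ℚ.* d ≡ a ℚ.* (b ℚ.- d) ℚ.+ d ℚ.* (a ℚ.- c)
    diff-* = solve 4 (λ a b c d → a :* b :- c :* d := a :* (b :- d) :+ d :* (a :- c)) refl

  open Identities

  ½-pos : ∀ {ε} → 0ℚ ℚ.< ε → 0ℚ ℚ.< ½ ℚ.* ε
  ½-pos {ε} p = ℚₚ.positive⁻¹ (½ ℚ.* ε) {{ℚₚ.pos*pos⇒pos ½ ε {{ℚ.positive p}}}}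

  halves : ∀ ε → ½ ℚ.* ε ℚ.+ ½ ℚ.* ε ≡ ε
  halves ε = trans (sym (ℚₚ.*-distribʳ-+ ε ½ ½)) (ℚₚ.*-identityˡ ε)

  const-cauchy : ∀ p → IsCauchy (λ _ → p)
  const-cauchy p ε 0<ε = 0 , λ i j _ _ →
    subst (λ z → ℚ.∣ z ∣ ℚ.≤ ε) (sym (ℚₚ.+-inverseʳ p)) (ℚₚ.<⇒≤ 0<ε)

  +-cauchy : ∀ {x y} → IsCauchy x → IsCauchy y → IsCauchy (λ i → x i ℚ.+ y i)
  +-cauchy {x} {y} cx cy ε 0<ε with cx (½ ℚ.* ε) (½-pos 0<ε) | cy (½ ℚ.* ε) (½-pos 0<ε)
  ... | M , hx | N , hy = M ℕ.⊔ N , λ i j p q → begin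
    ℚ.∣ (x i ℚ.+ y i) ℚ.- (x j ℚ.+ y j) ∣
      ≡⟨ cong ℚ.∣_∣ (diff-+ (x i) (y i) (x j) (y j)) ⟩
    ℚ.∣ (x i ℚ.- x j) ℚ.+ (y i ℚ.- y j) ∣
      ≤⟨ ℚₚ.∣p+q∣≤∣p∣+∣q∣ (x i ℚ.- x j) (y i ℚ.- y j) ⟩
    ℚ.∣ x i ℚ.- x j ∣ ℚ.+ ℚ.∣ y i ℚ.- y j ∣
      ≤⟨ ℚₚ.+-mono-≤ (hx i j (ℕₚ.m⊔n≤o⇒m≤o M N p) (ℕₚ.m⊔n≤o⇒m≤o M N q))
                     (hy i j (ℕₚ.m⊔n≤o⇒n≤o M N p) (ℕₚ.m⊔n≤o⇒n≤o M N q)) ⟩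
    ½ ℚ.* ε ℚ.+ ½ ℚ.* ε
      ≡⟨ halves ε ⟩
    ε ∎
    where
      open ℚₚ.≤-Reasoning

  neg-cauchy : ∀ {x} → IsCauchy x → IsCauchy (λ i → ℚ.- x i)
  neg-cauchy {x} cx ε 0<ε with cx ε 0<ε
  ... | N , h = N , λ i j p q → subst (ℚ._≤ ε) (sym (flip i j)) (h i j p q)
    where
      flip : ∀ i j → ℚ.∣ ℚ.- x i ℚ.- ℚ.- x j ∣ ≡ ℚ.∣ x i ℚ.- x j ∣
      flip i j = trans
        (cong ℚ.∣_∣ (diff-neg (x i) (x j)))
        (ℚₚ.∣-p∣≡∣p∣ (x i ℚ.- x j))

  eventually-bounded : ∀ {x} → IsCauchy x →
    Σ ℚ λ B → 0ℚ ℚ.< B × (∃ λ N → ∀ i → N ℕ.≤ i → ℚ.∣ x i ∣ ℚ.≤ B)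
  eventually-bounded {x} cx with cx 1ℚ (ℚₚ.positive⁻¹ 1ℚ)
  ... | N , h = ℚ.∣ x N ∣ ℚ.+ 1ℚ
              , ℚₚ.+-mono-≤-< (ℚₚ.0≤∣p∣ (x N)) (ℚₚ.positive⁻¹ 1ℚ)
              , N , λ i p → begin
    ℚ.∣ x i ∣
      ≡⟨ cong ℚ.∣_∣ (split (x i) (x N)) ⟩
    ℚ.∣ x N ℚ.+ (x i ℚ.- x N) ∣
      ≤⟨ ℚₚ.∣p+q∣≤∣p∣+∣q∣ (x N) (x i ℚ.- x N) ⟩
    ℚ.∣ x N ∣ ℚ.+ ℚ.∣ x i ℚ.- x N ∣
      ≤⟨ ℚₚ.+-monoʳ-≤ ℚ.∣ x N ∣ (h i N p ℕₚ.≤-refl) ⟩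
    ℚ.∣ x N ∣ ℚ.+ 1ℚ ∎
    where
      open ℚₚ.≤-Reasoning

  scale : ∀ {B} → 0ℚ ℚ.< B → ∀ {ε} → 0ℚ ℚ.< ε →
    Σ ℚ λ δ → 0ℚ ℚ.< δ × B ℚ.* δ ≡ ε
  scale {B} 0<B {ε} 0<ε =
      B⁻¹ ℚ.* ε
    , ℚₚ.positive⁻¹ (B⁻¹ ℚ.* ε) {{ℚₚ.pos*pos⇒pos B⁻¹ {{ℚₚ.1/pos⇒pos B {{B>0}}}} ε {{ℚ.positive 0<ε}}}}
    , trans (sym (ℚₚ.*-assoc B B⁻¹ ε))
        (trans (cong (ℚ._* ε) (ℚₚ.*-inverseʳ B {{B≢0}})) (ℚₚ.*-identityˡ ε))
    where
      B>0 : ℚ.Positive B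
      B>0 = ℚ.positive 0<B
      B≢0 : ℚ.NonZero B
      B≢0 = ℚₚ.pos⇒nonZero B {{B>0}}
      B⁻¹ : ℚ
      B⁻¹ = (ℚ.1/ B) {{B≢0}}

  *-mono-∣∣ : ∀ {p q B δ} → 0ℚ ℚ.< B → ℚ.∣ p ∣ ℚ.≤ B → ℚ.∣ q ∣ ℚ.≤ δ → ℚ.∣ p ℚ.* q ∣ ℚ.≤ B ℚ.* δ
  *-mono-∣∣ {p} {q} {B} {δ} 0<B hp hq = begin
    ℚ.∣ p ℚ.* q ∣
      ≡⟨ ℚₚ.∣p*q∣≡∣p∣*∣q∣ p q ⟩
    ℚ.∣ p ∣ ℚ.* ℚ.∣ q ∣
      ≤⟨ ℚₚ.*-monoʳ-≤-nonNeg ℚ.∣ q ∣ {{ℚ.nonNegative (ℚₚ.0≤∣p∣ q)}} hp ⟩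
    B ℚ.* ℚ.∣ q ∣
      ≤⟨ ℚₚ.*-monoˡ-≤-nonNeg B {{ℚ.nonNegative (ℚₚ.<⇒≤ 0<B)}} hq ⟩
    B ℚ.* δ ∎
    where open ℚₚ.≤-Reasoning

  *-near : ∀ {a b c d A B α β} → 0ℚ ℚ.< A → 0ℚ ℚ.< B →
    ℚ.∣ a ∣ ℚ.≤ A → ℚ.∣ d ∣ ℚ.≤ B → ℚ.∣ b ℚ.- d ∣ ℚ.≤ α → ℚ.∣ a ℚ.- c ∣ ℚ.≤ β →
    ℚ.∣ a ℚ.* b ℚ.- c ℚ.* d ∣ ℚ.≤ A ℚ.* α ℚ.+ B ℚ.* β
  *-near {a} {b} {c} {d} {A} {B} {α} {β} 0<A 0<B ha hd hbd hac = begin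
    ℚ.∣ a ℚ.* b ℚ.- c ℚ.* d ∣
      ≡⟨ cong ℚ.∣_∣ (diff-* a b c d) ⟩
    ℚ.∣ a ℚ.* (b ℚ.- d) ℚ.+ d ℚ.* (a ℚ.- c) ∣
      ≤⟨ ℚₚ.∣p+q∣≤∣p∣+∣q∣ (a ℚ.* (b ℚ.- d)) (d ℚ.* (a ℚ.- c)) ⟩
    ℚ.∣ a ℚ.* (b ℚ.- d) ∣ ℚ.+ ℚ.∣ d ℚ.* (a ℚ.- c) ∣
      ≤⟨ ℚₚ.+-mono-≤ (*-mono-∣∣ {a} {b ℚ.- d} {A} {α} 0<A ha hbd)
                     (*-mono-∣∣ {d} {a ℚ.- c} {B} {β} 0<B hd hac) ⟩
    A ℚ.* α ℚ.+ B ℚ.* β ∎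
    where open ℚₚ.≤-Reasoning

  *-cauchy : ∀ {x y} → IsCauchy x → IsCauchy y → IsCauchy (λ i → x i ℚ.* y i)
  *-cauchy {x} {y} cx cy ε 0<ε =
    let A , 0<A , K , hA = eventually-bounded {x} cx
        B , 0<B , L , hB = eventually-bounded {y} cy
        α , 0<α , Aα≡ = scale {A} 0<A {½ ℚ.* ε} (½-pos {ε} 0<ε)
        β , 0<β , Bβ≡ = scale {B} 0<B {½ ℚ.* ε} (½-pos {ε} 0<ε)
        M , hy = cy α 0<α
        N , hx = cx β 0<β
        KL : ∀ {i} → (K ℕ.⊔ L) ℕ.⊔ (M ℕ.⊔ N) ℕ.≤ i → K ℕ.⊔ L ℕ.≤ i
        KL = ℕₚ.m⊔n≤o⇒m≤o (K ℕ.⊔ L) (M ℕ.⊔ N)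
        MN : ∀ {i} → (K ℕ.⊔ L) ℕ.⊔ (M ℕ.⊔ N) ℕ.≤ i → M ℕ.⊔ N ℕ.≤ i
        MN = ℕₚ.m⊔n≤o⇒n≤o (K ℕ.⊔ L) (M ℕ.⊔ N)
    in (K ℕ.⊔ L) ℕ.⊔ (M ℕ.⊔ N) , λ i j p q →
      subst (ℚ.∣ x i ℚ.* y i ℚ.- x j ℚ.* y j ∣ ℚ.≤_)
        (trans (cong₂ ℚ._+_ Aα≡ Bβ≡) (halves ε))
        (*-near {x i} {y i} {x j} {y j} {A} {B} {α} {β} 0<A 0<B
          (hA i (ℕₚ.m⊔n≤o⇒m≤o K L (KL p)))
          (hB j (ℕₚ.m⊔n≤o⇒n≤o K L (KL q)))
          (hy i j (ℕₚ.m⊔n≤o⇒m≤o M N (MN p)) (ℕₚ.m⊔n≤o⇒m≤o M N (MN q)))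
          (hx i j (ℕₚ.m⊔n≤o⇒n≤o M N (MN p)) (ℕₚ.m⊔n≤o⇒n≤o M N (MN q))))

infixl 6 _+ℝ_ _-ℝ_
infixl 7 _*ℝ_

ℚtoℝ : ℚ → ℝ
ℚtoℝ p = mkℝ (λ _ → p) (const-cauchy p)

ℕtoℝ : ℕ → ℝ
ℕtoℝ n = ℚtoℝ (ℕtoℚ n)

0ℝ 1ℝ ½ℝ : ℝ
0ℝ = ℚtoℝ 0ℚ
1ℝ = ℚtoℝ 1ℚ
½ℝ = ℚtoℝ ½

_+ℝ_ : ℝ → ℝ → ℝ
x +ℝ y = mkℝ (λ i → seq x i ℚ.+ seq y i) (+-cauchy {seq x} {seq y} (cauchy x) (cauchy y))

_-ℝ_ : ℝ → ℝ → ℝ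
x -ℝ y = mkℝ (λ i → seq x i ℚ.- seq y i) (+-cauchy {seq x} {λ i → ℚ.- seq y i} (cauchy x) (neg-cauchy {seq y} (cauchy y)))

_*ℝ_ : ℝ → ℝ → ℝ
x *ℝ y = mkℝ (λ i → seq x i ℚ.* seq y i) (*-cauchy {seq x} {seq y} (cauchy x) (cauchy y))

partialSum : (ℕ → ℝ) → ℕ → ℝ
partialSum a zero    = 0ℝ
partialSum a (suc m) = partialSum a m +ℝ a m

HasSum : (ℕ → ℝ) → ℝ → Set
HasSum a s = ∀ (ε : ℚ) → 0ℚ ℚ.< ε → ∃ λ K → ∀ m → K ℕ.≤ m →
  partialSum a m ≤ℝ s +ℝ ℚtoℝ ε × s ≤ℝ partialSum a m +ℝ ℚtoℝ ε

-- An input of size n is the set of those i with aᵢ < b; its rank is the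
-- cardinality of this set.
Input : ℕ → Set
Input n = Subset n

rank : ∀ {n} → Input n → ℕ
rank x = ∣ x ∣

-- ∣ r - rank x ∣ ≤ n^(3/8) / 40, multiplied by 40 and raised to the 8th power
-- (both sides are nonnegative).
IsApproximation : ∀ {n} → Input n → ℚ → Set
IsApproximation {n} x r =
  (ℕtoℚ 40 ℚ.* ℚ.∣ r ℚ.- ℕtoℚ (rank x) ∣) ^ℚ 8 ℚ.≤ ℕtoℚ n ^ℚ 3

isApproximation? : ∀ {n} (x : Input n) (r : ℚ) → Dec (IsApproximation x r)
isApproximation? x r = _ ℚₚ.≤? _

-- In  query i t  the pair (aᵢ , b) is compared; the algorithm continues with
-- t true if the answer is "aᵢ < b" and with t false if it is "aᵢ > b".
data DecisionTree (n : ℕ) : Set where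
  output : ℚ → DecisionTree n
  query  : Fin n → (Bool → DecisionTree n) → DecisionTree n

depth : ∀ {n} → DecisionTree n → ℕ
depth (output r)  = 0
depth (query i t) = suc (depth (t true) ℕ.⊔ depth (t false))

answerProbability : ℝ → ∀ {n} → Input n → Fin n → Bool → ℝ
answerProbability γ x i answer =
  if does (answer ≟ᵇ lookup x i) then ½ℝ +ℝ ½ℝ *ℝ γ else ½ℝ -ℝ ½ℝ *ℝ γ

successProbability : ℝ → ∀ {n} → Input n → DecisionTree n → ℝ
successProbability γ x (output r)  = if does (isApproximation? x r) then 1ℝ else 0ℝ
successProbability γ x (query i t) =
  answerProbability γ x i true  *ℝ successProbability γ x (t true) +ℝ
  answerProbability γ x i false *ℝ successProbability γ x (t false)

-- A probability distribution on deterministic algorithms.  There are only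
-- countably many decision trees for a given n, so every such distribution is
-- the law of tree k for some ℕ-valued random variable k.
record RandomizedAlgorithm (n : ℕ) : Set where
  field
    weight      : ℕ → ℝ
    weight≥0    : ∀ k → 0ℝ ≤ℝ weight k
    weight-sums : HasSum weight 1ℝ
    tree        : ℕ → DecisionTree n

open RandomizedAlgorithm public

SucceedsOn : ∀ {n} → ℝ → RandomizedAlgorithm n → Input n → Set
SucceedsOn γ A x = Σ ℝ λ s →
  HasSum (λ k → weight A k *ℝ successProbability γ x (tree A k)) s ×
  ℚtoℝ (+ 2 ℚ./ 3) ≤ℝ s

SolvesRank : ∀ {n} → ℝ → RandomizedAlgorithm n → Set
SolvesRank {n} γ A = (x : Input n) → SucceedsOn γ A x

QueryComplexityAtMost : ∀ {n} → RandomizedAlgorithm n → ℕ → Set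
QueryComplexityAtMost A q = ∀ k → depth (tree A k) ℕ.≤ q

{-# OPTIONS --safe #-}
module Submission where

-- Let the input be uniformly random.  Given the answers seen so far, the bits
-- are independent with posterior probabilities pᵢ.  One query multiplies the
-- expectation of ∏ᵢ 1 / (4 pᵢ (1 - pᵢ)) by at most 1 + O(γ²), so after o(n log n / γ²)
-- queries this product is 2^o(n log n) except with tiny probability.  Then for at
-- least half of the i the factor 4 pᵢ (1 - pᵢ) exceeds n^(-1/8), and the posterior
-- variance V of the rank is much larger than n^(3/4).
-- The rank S is anticoncentrated: for f the clamping of S - r to [-T , T], Stein's
-- identity E (S - E S) f(S) = ∑ᵢ pᵢ (1 - pᵢ) E (f(Sᵢ + 1) - f(Sᵢ)), Sᵢ being S without
-- the i-th bit, bounds V P(∣S - r∣ ≤ T - 1) by T √V.  Hence no output is a good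
-- approximation with probability close to 2/3.
-- The reals are Cauchy sequences with pointwise operations, so a contradiction
-- is reached at a single large index, where all quantities are rational.

open import Defs
open import Algebra.Bundles using (CommutativeRing)
open import Data.Bool.Base using (Bool; true; false; if_then_else_)
open import Data.Bool.Properties using () renaming (_≟_ to _≟ᵇ_)
open import Data.Empty using (⊥)
open import Data.Fin.Base using (Fin; zero; suc)
import Data.Integer.Base as ℤ
import Data.Integer.Properties as ℤₚ
open import Data.Nat.Base as ℕ using (ℕ; zero; suc; _≤_)
open import Data.Nat.DivMod using (m≡m%n+[m/n]*n; m%n<n)
open import Data.Nat.Induction using (<-rec)
open import Data.Nat.Logarithm using (⌈log₂_⌉; ⌈log₂⌈n/2⌉⌉≡⌈log₂n⌉∸1; ⌈log₂⌉-mono-≤; ⌈log₂2^n⌉≡n)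
import Data.Nat.Properties as ℕₚ
open import Data.Nat.Tactic.RingSolver using (solve-∀)
open import Data.Product.Base using (Σ; ∃; _×_; _,_; proj₁; proj₂)
open import Data.Rational.Base as ℚ using (ℚ; 0ℚ; 1ℚ; ½; _+_; _*_; _-_; -_; _⊔_; _⊓_; _/_) renaming (_≤_ to _≤ℚ_; _<_ to _<ℚ_)
import Data.Rational.Properties as ℚₚ
open import Data.Rational.Solver using (module +-*-Solver)
import Data.Rational.Unnormalised.Base as ℚᵘ
import Data.Rational.Unnormalised.Properties as ℚᵘₚ
open import Data.Sum.Base using (_⊎_; inj₁; inj₂; map₂)
open import Data.Vec.Base using (Vec; []; _∷_; lookup; replicate; updateAt)
open import Data.Vec.Relation.Unary.All using (All; []; _∷_)
open import Relation.Binary.PropositionalEquality using (_≡_; refl; sym; trans; cong; cong₂; subst; subst₂)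
open import Relation.Nullary.Decidable using (decidable-stable)
open import Relation.Nullary.Decidable.Core using (Dec; does; yes; no)
open import Relation.Nullary.Negation.Core using (¬_; contradiction)

open import Algebra.Definitions.RawSemiring ℚ.+-*-rawSemiring using () renaming (_^_ to _^ℚ_)
import Algebra.Properties.CommutativeSemiring.Exp (CommutativeRing.commutativeSemiring ℚₚ.+-*-commutativeRing) as Exp
open +-*-Solver using (solve; _:=_; _:+_; _:*_; _:-_; :-_; con)

-- Ordered-field arithmetic in ℚ

0≤+ : ∀ {p q} → 0ℚ ≤ℚ p → 0ℚ ≤ℚ q → 0ℚ ≤ℚ p + q
0≤+ = ℚₚ.+-mono-≤

0≤* : ∀ {p q} → 0ℚ ≤ℚ p → 0ℚ ≤ℚ q → 0ℚ ≤ℚ p * q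
0≤* {p} {q} 0≤p 0≤q = ℚₚ.nonNegative⁻¹ (p * q)
  {{ℚₚ.nonNeg*nonNeg⇒nonNeg p {{ℚ.nonNegative 0≤p}} q {{ℚ.nonNegative 0≤q}}}}

0<* : ∀ {p q} → 0ℚ <ℚ p → 0ℚ <ℚ q → 0ℚ <ℚ p * q
0<* {p} {q} 0<p 0<q = ℚₚ.positive⁻¹ (p * q)
  {{ℚₚ.pos*pos⇒pos p {{ℚ.positive 0<p}} q {{ℚ.positive 0<q}}}}

0≤- : ∀ {p q} → p ≤ℚ q → 0ℚ ≤ℚ q - p
0≤- {p} {q} p≤q = subst (_≤ℚ q - p) (ℚₚ.+-inverseʳ p) (ℚₚ.+-monoˡ-≤ (- p) p≤q)

-- The pattern of most inequalities below: `r` is a certificate, a sum of products of nonnegative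
-- terms, and the ring solver checks that it equals the difference.
≤-from-diff : ∀ {p q r} → 0ℚ ≤ℚ r → q - p ≡ r → p ≤ℚ q
≤-from-diff {p} {q} {r} 0≤r eq = subst₂ _≤ℚ_ (ℚₚ.+-identityʳ p) (p+r≡q p q r eq) (ℚₚ.+-monoʳ-≤ p 0≤r)
  where
  p+r≡q : ∀ p q r → q - p ≡ r → p + r ≡ q
  p+r≡q p q _ refl = solve 2 (λ p q → p :+ (q :- p) := q) refl p q

0≤² : ∀ p → 0ℚ ≤ℚ p * p
0≤² p with ℚₚ.≤-total 0ℚ p
... | inj₁ 0≤p = 0≤* 0≤p 0≤p
... | inj₂ p≤0 = subst (0ℚ ≤ℚ_) (neg² p) (0≤* 0≤-p 0≤-p)
  where
  neg² : ∀ p → - p * - p ≡ p * p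
  neg² = solve 1 (λ p → (:- p) :* (:- p) := p :* p) refl
  0≤-p : 0ℚ ≤ℚ - p
  0≤-p = ℚₚ.neg-antimono-≤ p≤0

*-monoˡ : ∀ {r p q} → 0ℚ ≤ℚ r → p ≤ℚ q → r * p ≤ℚ r * q
*-monoˡ {r} 0≤r = ℚₚ.*-monoˡ-≤-nonNeg r {{ℚ.nonNegative 0≤r}}

*-monoʳ : ∀ {r p q} → 0ℚ ≤ℚ r → p ≤ℚ q → p * r ≤ℚ q * r
*-monoʳ {r} 0≤r = ℚₚ.*-monoʳ-≤-nonNeg r {{ℚ.nonNegative 0≤r}}

*-mono : ∀ {p q r s} → 0ℚ ≤ℚ p → 0ℚ ≤ℚ s → p ≤ℚ q → r ≤ℚ s → p * r ≤ℚ q * s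
*-mono 0≤p 0≤s p≤q r≤s = ℚₚ.≤-trans (*-monoˡ 0≤p r≤s) (*-monoʳ 0≤s p≤q)

*-cancelˡ : ∀ {r p q} → 0ℚ <ℚ r → r * p ≤ℚ r * q → p ≤ℚ q
*-cancelˡ {r} 0<r = ℚₚ.*-cancelˡ-≤-pos r {{ℚ.positive 0<r}}

inverse : ∀ {p} → 0ℚ <ℚ p → Σ ℚ λ r → 0ℚ <ℚ r × r * p ≡ 1ℚ
inverse {p} 0<p = (ℚ.1/ p) {{p≢0}} , ℚₚ.positive⁻¹ _ {{ℚₚ.1/pos⇒pos p {{p>0}}}} , ℚₚ.*-inverseˡ p {{p≢0}}
  where
  p>0 : ℚ.Positive p
  p>0 = ℚ.positive 0<p
  p≢0 : ℚ.NonZero p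
  p≢0 = ℚₚ.pos⇒nonZero p {{p>0}}

-- Product measures on bit vectors and the moments of the bit count

-- A vector of pairs (aᵢ , bᵢ) stands for the measure on {0,1}ⁿ that gives x the
-- mass ∏ᵢ (if xᵢ then aᵢ else bᵢ).
Weights : ℕ → Set
Weights = Vec (ℚ × ℚ)

∫ : ∀ {n} → Weights n → (Vec Bool n → ℚ) → ℚ
∫ []            F = F []
∫ ((a , b) ∷ v) F = a * ∫ v (λ x → F (true ∷ x)) + b * ∫ v (λ x → F (false ∷ x))

NonNegWeights PosWeights Probability : ∀ {n} → Weights n → Set
NonNegWeights = All (λ (a , b) → 0ℚ ≤ℚ a × 0ℚ ≤ℚ b)
PosWeights    = All (λ (a , b) → 0ℚ <ℚ a × 0ℚ <ℚ b)
Probability   = All (λ (a , b) → (0ℚ ≤ℚ a × 0ℚ ≤ℚ b) × a + b ≡ 1ℚ)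

prob⇒nonNeg : ∀ {n} {v : Weights n} → Probability v → NonNegWeights v
prob⇒nonNeg []             = []
prob⇒nonNeg ((nn , _) ∷ P) = nn ∷ prob⇒nonNeg P

pos⇒nonNeg : ∀ {n} {v : Weights n} → PosWeights v → NonNegWeights v
pos⇒nonNeg []              = []
pos⇒nonNeg ((p , q) ∷ P) = (ℚₚ.<⇒≤ p , ℚₚ.<⇒≤ q) ∷ pos⇒nonNeg P

∫-cong : ∀ {n} (v : Weights n) {F G} → (∀ x → F x ≡ G x) → ∫ v F ≡ ∫ v G
∫-cong []            h = h []
∫-cong ((a , b) ∷ v) h = cong₂ (λ s t → a * s + b * t) (∫-cong v (λ x → h _)) (∫-cong v (λ x → h _))

∫-mono : ∀ {n} {v : Weights n} {F G} → NonNegWeights v → (∀ x → F x ≤ℚ G x) → ∫ v F ≤ℚ ∫ v G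
∫-mono []              h = h []
∫-mono ((p , q) ∷ P) h = ℚₚ.+-mono-≤ (*-monoˡ p (∫-mono P (λ x → h _))) (*-monoˡ q (∫-mono P (λ x → h _)))

∫-+ : ∀ {n} (v : Weights n) F G → ∫ v (λ x → F x + G x) ≡ ∫ v F + ∫ v G
∫-+ []            F G = refl
∫-+ ((a , b) ∷ v) F G = trans
  (cong₂ (λ s t → a * s + b * t) (∫-+ v _ _) (∫-+ v _ _))
  (solve 6 (λ a b s t s′ t′ → a :* (s :+ s′) :+ b :* (t :+ t′) := (a :* s :+ b :* t) :+ (a :* s′ :+ b :* t′))
     refl a b _ _ _ _)

∫-*ˡ : ∀ {n} (v : Weights n) c F → ∫ v (λ x → c * F x) ≡ c * ∫ v F
∫-*ˡ []            c F = refl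
∫-*ˡ ((a , b) ∷ v) c F = trans
  (cong₂ (λ s t → a * s + b * t) (∫-*ˡ v c _) (∫-*ˡ v c _))
  (solve 5 (λ a b c s t → a :* (c :* s) :+ b :* (c :* t) := c :* (a :* s :+ b :* t)) refl a b c _ _)

∫-linear : ∀ {n} (v : Weights n) c F G → ∫ v (λ x → F x + c * G x) ≡ ∫ v F + c * ∫ v G
∫-linear v c F G = trans (∫-+ v F (λ x → c * G x)) (cong (∫ v F +_) (∫-*ˡ v c G))

total : ∀ {n} → Weights n → ℚ
total []            = 1ℚ
total ((a , b) ∷ v) = (a + b) * total v

∫-1 : ∀ {n} (v : Weights n) → ∫ v (λ _ → 1ℚ) ≡ total v
∫-1 []            = refl
∫-1 ((a , b) ∷ v) = trans (cong (λ s → a * s + b * s) (∫-1 v)) (sym (ℚₚ.*-distribʳ-+ (total v) a b))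

∫-const : ∀ {n} (v : Weights n) c → ∫ v (λ _ → c) ≡ c * total v
∫-const v c = trans (∫-cong v (λ _ → sym (ℚₚ.*-identityʳ c))) (trans (∫-*ˡ v c (λ _ → 1ℚ)) (cong (c *_) (∫-1 v)))

total-prob : ∀ {n} {v : Weights n} → Probability v → total v ≡ 1ℚ
total-prob []             = refl
total-prob ((_ , e) ∷ P) = cong₂ _*_ e (total-prob P)

size : ∀ {n} → Vec Bool n → ℚ
size []          = 0ℚ
size (true  ∷ x) = size x + 1ℚ
size (false ∷ x) = size x

mean variance : ∀ {n} → Weights n → ℚ
mean []            = 0ℚ
mean ((a , b) ∷ v) = a + mean v
variance []            = 0ℚ
variance ((a , b) ∷ v) = a * b + variance v

-- Conditioning on the first bit shifts the centred sum of the others by `b` or by `- a`. Weighted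
-- by `a` and `b` the cross terms cancel, so the value of `∫ v Y` does not have to be computed.
∫-[size-mean]² : ∀ {n} {v : Weights n} → Probability v →
  ∫ v (λ x → (size x - mean v) * (size x - mean v)) ≡ variance v
∫-[size-mean]² [] = refl
∫-[size-mean]² {v = (a , b) ∷ v} ((_ , a+b≡1) ∷ P) = trans
  (cong₂ (λ s t → a * s + b * t) (branch b (λ x → size x + 1ℚ) (λ x → up (size x) a b (mean v) a+b≡1))
                                 (branch (- a) size (λ x → down (size x) a (mean v))))
  (trans (collect a b _ _) (cong₂ _+_
    (trans (cong (a * b *_) a+b≡1) (ℚₚ.*-identityʳ (a * b)))
    (trans (cong (_* variance v) a+b≡1) (ℚₚ.*-identityˡ (variance v)))))
  where
  Y : Vec Bool _ → ℚ
  Y x = size x - mean v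
  up : ∀ s a b m → a + b ≡ 1ℚ → (s + 1ℚ) - (a + m) ≡ (s - m) + b
  up s a b m e = trans (cong (λ z → (s + z) - (a + m)) (sym e))
    (solve 4 (λ s a b m → (s :+ (a :+ b)) :- (a :+ m) := (s :- m) :+ b) refl s a b m)
  down : ∀ s a m → s - (a + m) ≡ (s - m) + - a
  down = solve 3 (λ s a m → s :- (a :+ m) := (s :- m) :+ :- a) refl
  square : ∀ y d → (y + d) * (y + d) ≡ y * y + ((d + d) * y + d * d)
  square = solve 2 (λ y d → (y :+ d) :* (y :+ d) := y :* y :+ ((d :+ d) :* y :+ d :* d)) refl
  branch : ∀ d (S : Vec Bool _ → ℚ) → (∀ x → S x - (a + mean v) ≡ Y x + d) →
    ∫ v (λ x → (S x - (a + mean v)) * (S x - (a + mean v))) ≡ variance v + ((d + d) * ∫ v Y + d * d)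
  branch d S h = trans
    (∫-cong v (λ x → trans (cong₂ _*_ (h x) (h x)) (square (Y x) d)))
    (trans (∫-+ v _ _) (cong₂ _+_ (∫-[size-mean]² P)
      (trans (∫-+ v _ _) (cong₂ _+_ (∫-*ˡ v (d + d) Y)
        (trans (∫-const v (d * d)) (trans (cong (d * d *_) (total-prob P)) (ℚₚ.*-identityʳ (d * d))))))))
  collect : ∀ a b V m → a * (V + ((b + b) * m + b * b)) + b * (V + ((- a + - a) * m + - a * - a))
    ≡ a * b * (a + b) + (a + b) * V
  collect = solve 4 (λ a b V m →
    a :* (V :+ ((b :+ b) :* m :+ b :* b)) :+ b :* (V :+ ((:- a :+ :- a) :* m :+ :- a :* :- a))
    := a :* b :* (a :+ b) :+ (a :+ b) :* V) refl

-- Stein's identity for a sum of independent Bernoulli variables, weakened to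
-- an inequality so that the leave-one-out sums do not appear.
stein : ∀ {n} {v : Weights n} → Probability v → (f w : ℚ → ℚ) →
  (∀ y → w y ≤ℚ f (y + 1ℚ) - f y) → (∀ y → w (y + 1ℚ) ≤ℚ f (y + 1ℚ) - f y) →
  variance v * ∫ v (λ x → w (size x)) ≤ℚ ∫ v (λ x → (size x - mean v) * f (size x))
stein [] f w h₀ h₁ = ℚₚ.≤-reflexive (trans (ℚₚ.*-zeroˡ (w 0ℚ)) (sym (ℚₚ.*-zeroˡ (f 0ℚ))))
stein {v = (a , b) ∷ v} (((0≤a , 0≤b) , a+b≡1) ∷ P) f w h₀ h₁ =
  subst (variance ((a , b) ∷ v) * ∫ ((a , b) ∷ v) (λ x → w (size x)) ≤ℚ_) (sym split)
    (≤-from-diff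
      (0≤+ (0≤+ (0≤* 0≤a (0≤- IH₁)) (0≤* 0≤b (0≤- IH₀)))
           (0≤* (0≤* 0≤a 0≤b) (0≤+ (0≤* 0≤a (0≤- W₁≤)) (0≤* 0≤b (0≤- W₀≤)))))
      (trans (cong (λ z → (a * A₁ + b * A₀) + a * b * z - (a * b + variance v) * (a * W₁ + b * W₀))
               (sym (trans (cong (_* (F₁ - F₀)) a+b≡1) (ℚₚ.*-identityˡ (F₁ - F₀)))))
             (rearrange a b A₁ A₀ (F₁ - F₀) W₁ W₀ (variance v))))
  where
  f₁ w₁ : ℚ → ℚ
  f₁ y = f (y + 1ℚ)
  w₁ y = w (y + 1ℚ)
  Y : Vec Bool _ → ℚ
  Y x = size x - mean v
  A₁ A₀ F₁ F₀ W₁ W₀ : ℚ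
  A₁ = ∫ v (λ x → Y x * f₁ (size x))
  A₀ = ∫ v (λ x → Y x * f (size x))
  F₁ = ∫ v (λ x → f₁ (size x))
  F₀ = ∫ v (λ x → f (size x))
  W₁ = ∫ v (λ x → w₁ (size x))
  W₀ = ∫ v (λ x → w (size x))
  IH₁ : variance v * W₁ ≤ℚ A₁
  IH₁ = stein P f₁ w₁ (λ y → h₀ (y + 1ℚ)) (λ y → h₁ (y + 1ℚ))
  IH₀ : variance v * W₀ ≤ℚ A₀
  IH₀ = stein P f w h₀ h₁
  F-diff : ∫ v (λ x → f₁ (size x) - f (size x)) ≡ F₁ - F₀
  F-diff = trans (∫-cong v (λ x → neg (f₁ (size x)) (f (size x))))
    (trans (∫-linear v (- 1ℚ) (λ x → f₁ (size x)) (λ x → f (size x))) (sym (neg F₁ F₀)))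
    where
    neg : ∀ p q → p - q ≡ p + - 1ℚ * q
    neg = solve 2 (λ p q → p :- q := p :+ con (- 1ℚ) :* q) refl
  -- The two hypotheses on `w` serve the two values of the first bit: if it is set, the whole sum
  -- exceeds the rest by one and `h₁` applies, otherwise `h₀`.
  W₁≤ : W₁ ≤ℚ F₁ - F₀
  W₁≤ = subst (W₁ ≤ℚ_) F-diff (∫-mono (prob⇒nonNeg P) (λ x → h₁ (size x)))
  W₀≤ : W₀ ≤ℚ F₁ - F₀
  W₀≤ = subst (W₀ ≤ℚ_) F-diff (∫-mono (prob⇒nonNeg P) (λ x → h₀ (size x)))
  up : ∀ s a b m φ → a + b ≡ 1ℚ → ((s + 1ℚ) - (a + m)) * φ ≡ (s - m) * φ + b * φ
  up s a b m φ e = trans (cong (λ z → ((s + z) - (a + m)) * φ) (sym e))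
    (solve 5 (λ s a b m φ → ((s :+ (a :+ b)) :- (a :+ m)) :* φ := (s :- m) :* φ :+ b :* φ) refl s a b m φ)
  down : ∀ s a m φ → (s - (a + m)) * φ ≡ (s - m) * φ + - a * φ
  down = solve 4 (λ s a m φ → (s :- (a :+ m)) :* φ := (s :- m) :* φ :+ :- a :* φ) refl
  collect : ∀ a b A₁ A₀ F₁ F₀ → a * (A₁ + b * F₁) + b * (A₀ + - a * F₀) ≡ (a * A₁ + b * A₀) + a * b * (F₁ - F₀)
  collect = solve 6 (λ a b A₁ A₀ F₁ F₀ →
    a :* (A₁ :+ b :* F₁) :+ b :* (A₀ :+ :- a :* F₀) := (a :* A₁ :+ b :* A₀) :+ a :* b :* (F₁ :- F₀)) refl
  -- The shifts `b` and `- a` of the centred sum produce the first bit's own term of Stein's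
  -- identity, a b E (f(S + 1) - f(S)) with S the sum of the rest.
  split : ∫ ((a , b) ∷ v) (λ x → (size x - mean ((a , b) ∷ v)) * f (size x))
    ≡ (a * A₁ + b * A₀) + a * b * (F₁ - F₀)
  split = trans
    (cong₂ (λ s t → a * s + b * t)
      (trans (∫-cong v (λ x → up (size x) a b (mean v) (f₁ (size x)) a+b≡1))
             (∫-linear v b (λ x → Y x * f₁ (size x)) (λ x → f₁ (size x))))
      (trans (∫-cong v (λ x → down (size x) a (mean v) (f (size x))))
             (∫-linear v (- a) (λ x → Y x * f (size x)) (λ x → f (size x)))))
    (collect a b A₁ A₀ F₁ F₀)
  rearrange : ∀ a b A₁ A₀ G W₁ W₀ V →
    (a * A₁ + b * A₀) + a * b * ((a + b) * G) - (a * b + V) * (a * W₁ + b * W₀)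
    ≡ (a * (A₁ - V * W₁) + b * (A₀ - V * W₀)) + a * b * (a * (G - W₁) + b * (G - W₀))
  rearrange = solve 8 (λ a b A₁ A₀ G W₁ W₀ V →
    (a :* A₁ :+ b :* A₀) :+ a :* b :* ((a :+ b) :* G) :- (a :* b :+ V) :* (a :* W₁ :+ b :* W₀)
    := (a :* (A₁ :- V :* W₁) :+ b :* (A₀ :- V :* W₀)) :+ a :* b :* (a :* (G :- W₁) :+ b :* (G :- W₀))) refl

-- The embedding of ℕ into ℚ, and powers

<⇒≱ : ∀ {p q} → p <ℚ q → ¬ q ≤ℚ p
<⇒≱ p<q q≤p = ℚₚ.<-irrefl refl (ℚₚ.<-≤-trans p<q q≤p)

-- Inserts a factor known to be 1, such as `r * (a + b)` for a reciprocal `r`, after which what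
-- remains is a polynomial identity.
≡1⇒≡* : ∀ {u p} → u ≡ 1ℚ → p ≡ u * p
≡1⇒≡* {p = p} refl = sym (ℚₚ.*-identityˡ p)

ℕtoℚ-+ : ∀ m n → ℕtoℚ (m ℕ.+ n) ≡ ℕtoℚ m + ℕtoℚ n
ℕtoℚ-+ m n = ℚₚ.toℚᵘ-injective (begin
  ℚ.toℚᵘ (ℕtoℚ (m ℕ.+ n))                ≈⟨ ℚₚ.toℚᵘ-fromℚᵘ (ℚᵘ.mkℚᵘ (ℤ.+ (m ℕ.+ n)) 0) ⟩
  ℚᵘ.mkℚᵘ (ℤ.+ (m ℕ.+ n)) 0              ≈⟨ ℚᵘ.*≡* (cong (ℤ._* ℤ.1ℤ) (sym (cong₂ ℤ._+_ (ℤₚ.*-identityʳ (ℤ.+ m)) (ℤₚ.*-identityʳ (ℤ.+ n))))) ⟩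
  ℚᵘ.mkℚᵘ (ℤ.+ m) 0 ℚᵘ.+ ℚᵘ.mkℚᵘ (ℤ.+ n) 0
    ≈⟨ ℚᵘₚ.+-cong (ℚₚ.toℚᵘ-fromℚᵘ (ℚᵘ.mkℚᵘ (ℤ.+ m) 0)) (ℚₚ.toℚᵘ-fromℚᵘ (ℚᵘ.mkℚᵘ (ℤ.+ n) 0)) ⟨
  ℚ.toℚᵘ (ℕtoℚ m) ℚᵘ.+ ℚ.toℚᵘ (ℕtoℚ n)   ≈⟨ ℚₚ.toℚᵘ-homo-+ (ℕtoℚ m) (ℕtoℚ n) ⟨
  ℚ.toℚᵘ (ℕtoℚ m + ℕtoℚ n)               ∎)
  where open ℚᵘₚ.≃-Reasoning

ℕtoℚ-suc : ∀ n → ℕtoℚ (suc n) ≡ ℕtoℚ n + 1ℚ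
ℕtoℚ-suc n = trans (ℕtoℚ-+ 1 n) (ℚₚ.+-comm 1ℚ (ℕtoℚ n))

ℕtoℚ-* : ∀ m n → ℕtoℚ (m ℕ.* n) ≡ ℕtoℚ m * ℕtoℚ n
ℕtoℚ-* zero    n = sym (ℚₚ.*-zeroˡ (ℕtoℚ n))
ℕtoℚ-* (suc m) n = trans (ℕtoℚ-+ n (m ℕ.* n)) (trans (cong (ℕtoℚ n +_) (ℕtoℚ-* m n))
  (trans (distrib (ℕtoℚ m) (ℕtoℚ n)) (cong (_* ℕtoℚ n) (sym (ℕtoℚ-suc m)))))
  where
  distrib : ∀ p q → q + p * q ≡ (p + 1ℚ) * q
  distrib = solve 2 (λ p q → q :+ p :* q := (p :+ con 1ℚ) :* q) refl

ℕtoℚ-^ : ∀ m n → ℕtoℚ (m ℕ.^ n) ≡ ℕtoℚ m ^ℚ n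
ℕtoℚ-^ m zero    = refl
ℕtoℚ-^ m (suc n) = trans (ℕtoℚ-* m (m ℕ.^ n)) (cong (ℕtoℚ m *_) (ℕtoℚ-^ m n))

ℕtoℚ≥0 : ∀ n → 0ℚ ≤ℚ ℕtoℚ n
ℕtoℚ≥0 zero    = ℚₚ.≤-refl
ℕtoℚ≥0 (suc n) = subst (0ℚ ≤ℚ_) (sym (ℕtoℚ-suc n)) (0≤+ (ℕtoℚ≥0 n) (ℚₚ.nonNegative⁻¹ 1ℚ))

ℕtoℚ-mono : ∀ {m n} → m ≤ n → ℕtoℚ m ≤ℚ ℕtoℚ n
ℕtoℚ-mono {m} {n} m≤n = subst₂ _≤ℚ_ (ℚₚ.+-identityʳ (ℕtoℚ m))
  (trans (sym (ℕtoℚ-+ m (n ℕ.∸ m))) (cong ℕtoℚ (ℕₚ.m+[n∸m]≡n m≤n)))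
  (ℚₚ.+-monoʳ-≤ (ℕtoℚ m) (ℕtoℚ≥0 (n ℕ.∸ m)))

ℕtoℚ-cancel-≤ : ∀ {m n} → ℕtoℚ m ≤ℚ ℕtoℚ n → m ≤ n
ℕtoℚ-cancel-≤ {m} {n} h with m ℕₚ.≤? n
... | yes m≤n = m≤n
... | no  m≰n = contradiction
  (ℚₚ.≤-trans (subst (_≤ℚ ℕtoℚ m) (ℕtoℚ-suc n) (ℕtoℚ-mono (ℕₚ.≰⇒> m≰n))) h)
  (<⇒≱ (subst (_<ℚ ℕtoℚ n + 1ℚ) (ℚₚ.+-identityʳ (ℕtoℚ n)) (ℚₚ.+-monoʳ-< (ℕtoℚ n) (ℚₚ.positive⁻¹ 1ℚ))))

size≡rank : ∀ {n} (x : Input n) → size x ≡ ℕtoℚ (rank x)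
size≡rank []          = refl
size≡rank (true  ∷ x) = trans (cong (_+ 1ℚ) (size≡rank x)) (sym (ℕtoℚ-suc (rank x)))
size≡rank (false ∷ x) = size≡rank x

^ℚ≥0 : ∀ {p} n → 0ℚ ≤ℚ p → 0ℚ ≤ℚ p ^ℚ n
^ℚ≥0 zero    0≤p = ℚₚ.nonNegative⁻¹ 1ℚ
^ℚ≥0 (suc n) 0≤p = 0≤* 0≤p (^ℚ≥0 n 0≤p)

^ℚ-monoˡ : ∀ {p q} n → 0ℚ ≤ℚ p → p ≤ℚ q → p ^ℚ n ≤ℚ q ^ℚ n
^ℚ-monoˡ zero    0≤p p≤q = ℚₚ.≤-refl
^ℚ-monoˡ (suc n) 0≤p p≤q = *-mono 0≤p (^ℚ≥0 n (ℚₚ.≤-trans 0≤p p≤q)) p≤q (^ℚ-monoˡ n 0≤p p≤q)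

1≤^ℚ : ∀ {p} n → 1ℚ ≤ℚ p → 1ℚ ≤ℚ p ^ℚ n
1≤^ℚ zero    1≤p = ℚₚ.≤-refl
1≤^ℚ (suc n) 1≤p = *-mono (ℚₚ.nonNegative⁻¹ 1ℚ) (ℚₚ.≤-trans (ℚₚ.nonNegative⁻¹ 1ℚ) (1≤^ℚ n 1≤p)) 1≤p (1≤^ℚ n 1≤p)

^ℚ≤1 : ∀ {p} n → 0ℚ ≤ℚ p → p ≤ℚ 1ℚ → p ^ℚ n ≤ℚ 1ℚ
^ℚ≤1 zero    0≤p p≤1 = ℚₚ.≤-refl
^ℚ≤1 (suc n) 0≤p p≤1 = *-mono 0≤p (ℚₚ.nonNegative⁻¹ 1ℚ) p≤1 (^ℚ≤1 n 0≤p p≤1)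

^ℚ-antimonoʳ : ∀ {p m n} → 0ℚ ≤ℚ p → p ≤ℚ 1ℚ → m ≤ n → p ^ℚ n ≤ℚ p ^ℚ m
^ℚ-antimonoʳ {n = n} 0≤p p≤1 ℕ.z≤n   = ^ℚ≤1 n 0≤p p≤1
^ℚ-antimonoʳ         0≤p p≤1 (ℕ.s≤s m≤n) = *-monoˡ 0≤p (^ℚ-antimonoʳ 0≤p p≤1 m≤n)

-- Anticoncentration

clamp : ℚ → ℚ → ℚ
clamp T y = (- T ⊔ y) ⊓ T

clamp-mono : ∀ T {y z} → y ≤ℚ z → clamp T y ≤ℚ clamp T z
clamp-mono T y≤z = ℚₚ.⊓-monoˡ-≤ T (ℚₚ.⊔-monoʳ-≤ (- T) y≤z)

clamp-inside : ∀ {T y} → - T ≤ℚ y → y ≤ℚ T → clamp T y ≡ y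
clamp-inside {T} {y} l u = trans (cong (_⊓ T) (ℚₚ.p≤q⇒p⊔q≡q l)) (ℚₚ.p≤q⇒p⊓q≡p u)

clamp² : ∀ {T} y → 0ℚ ≤ℚ T → clamp T y * clamp T y ≤ℚ T * T
clamp² {T} y 0≤T = ≤-from-diff (0≤* (0≤- upper) (0≤- lower)) (factor T (clamp T y))
  where
  upper : clamp T y ≤ℚ T
  upper = ℚₚ.p⊓q≤q (- T ⊔ y) T
  -T≤T : - T ≤ℚ T
  -T≤T = ℚₚ.≤-trans (ℚₚ.neg-antimono-≤ 0≤T) 0≤T
  lower : - T ≤ℚ clamp T y
  lower = ℚₚ.⊓-glb (ℚₚ.p≤p⊔q (- T) y) -T≤T
  factor : ∀ T c → T * T - c * c ≡ (T - c) * (c - - T)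
  factor = solve 2 (λ T c → T :* T :- c :* c := (T :- c) :* (c :- (:- T))) refl

-- An upper bound by the indicator of ∣y - r∣ ≤ T - 1. The margin 1 leaves room for a unit step to
-- either side within distance T of r, where the clamping has slope 1.
SupportedNear : ℚ → ℚ → (ℚ → ℚ) → Set
SupportedNear T r w = ∀ y → w y ≤ℚ 0ℚ ⊎ (w y ≤ℚ 1ℚ × 1ℚ - T ≤ℚ y - r × y - r ≤ℚ T - 1ℚ)

module _ {T r : ℚ} {w : ℚ → ℚ} (near : SupportedNear T r w) where

  private
    f : ℚ → ℚ
    f y = clamp T (y - r)

    f-mono : ∀ y → 0ℚ ≤ℚ f (y + 1ℚ) - f y
    f-mono y = 0≤- (clamp-mono T (≤-from-diff (ℚₚ.nonNegative⁻¹ 1ℚ)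
      (solve 2 (λ y r → y :+ con 1ℚ :- r :- (y :- r) := con 1ℚ) refl y r)))

    f-step : ∀ y → - T ≤ℚ y - r → y + 1ℚ - r ≤ℚ T → 1ℚ ≤ℚ f (y + 1ℚ) - f y
    f-step y l u = ℚₚ.≤-reflexive (sym (trans
      (cong₂ _-_ (clamp-inside (ℚₚ.≤-trans l step) u) (clamp-inside l (ℚₚ.≤-trans step u)))
      (diff y r)))
      where
      diff : ∀ y r → y + 1ℚ - r - (y - r) ≡ 1ℚ
      diff = solve 2 (λ y r → y :+ con 1ℚ :- r :- (y :- r) := con 1ℚ) refl
      step : y - r ≤ℚ y + 1ℚ - r
      step = ≤-from-diff (ℚₚ.nonNegative⁻¹ 1ℚ) (diff y r)

    w≤₀ : ∀ y → w y ≤ℚ f (y + 1ℚ) - f y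
    w≤₀ y with near y
    ... | inj₁ w≤0 = ℚₚ.≤-trans w≤0 (f-mono y)
    ... | inj₂ (w≤1 , l , u) = ℚₚ.≤-trans w≤1 (f-step y
      (≤-from-diff (0≤+ (0≤- l) (ℚₚ.nonNegative⁻¹ 1ℚ))
        (solve 3 (λ y r T → y :- r :- (:- T) := (y :- r :- (con 1ℚ :- T)) :+ con 1ℚ) refl y r T))
      (≤-from-diff (0≤- u)
        (solve 3 (λ y r T → T :- (y :+ con 1ℚ :- r) := T :- con 1ℚ :- (y :- r)) refl y r T)))

    w≤₁ : ∀ y → w (y + 1ℚ) ≤ℚ f (y + 1ℚ) - f y
    w≤₁ y with near (y + 1ℚ)
    ... | inj₁ w≤0 = ℚₚ.≤-trans w≤0 (f-mono y)
    ... | inj₂ (w≤1 , l , u) = ℚₚ.≤-trans w≤1 (f-step y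
      (≤-from-diff (0≤- l)
        (solve 3 (λ y r T → y :- r :- (:- T) := (y :+ con 1ℚ :- r :- (con 1ℚ :- T))) refl y r T))
      (≤-from-diff (0≤+ (0≤- u) (ℚₚ.nonNegative⁻¹ 1ℚ))
        (solve 3 (λ y r T → T :- (y :+ con 1ℚ :- r) := (T :- con 1ℚ :- (y :+ con 1ℚ :- r)) :+ con 1ℚ) refl y r T)))

  -- y f ≤ 5 f² + y² / 20 replaces Cauchy–Schwarz, which would need √V.
  anticoncentration : ∀ {n} {v : Weights n} → Probability v → 0ℚ ≤ℚ T →
    variance v * ∫ v (λ x → w (size x)) ≤ℚ ℕtoℚ 5 * (T * T) + ℤ.+ 1 / 20 * variance v
  anticoncentration {v = v} P 0≤T = ℚₚ.≤-trans (stein P f w w≤₀ w≤₁) (ℚₚ.≤-trans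
    (∫-mono (prob⇒nonNeg P) (λ x → am-gm (size x - mean v) (size x)))
    (ℚₚ.≤-reflexive (trans (∫-linear v (ℤ.+ 1 / 20) (λ _ → ℕtoℚ 5 * (T * T)) _)
      (cong₂ (λ s t → s + ℤ.+ 1 / 20 * t)
        (trans (∫-const v (ℕtoℚ 5 * (T * T))) (trans (cong (ℕtoℚ 5 * (T * T) *_) (total-prob P)) (ℚₚ.*-identityʳ (ℕtoℚ 5 * (T * T)))))
        (∫-[size-mean]² P)))))
    where
    am-gm : ∀ y s → y * f s ≤ℚ ℕtoℚ 5 * (T * T) + ℤ.+ 1 / 20 * (y * y)
    am-gm y s = ≤-from-diff
      (0≤+ (0≤* {ℕtoℚ 5} (ℚₚ.nonNegative⁻¹ _) (0≤- (clamp² (s - r) 0≤T)))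
           (0≤* {ℤ.+ 1 / 20} (ℚₚ.nonNegative⁻¹ _) (0≤² (y - ℕtoℚ 10 * f s))))
      (solve 3 (λ y φ T → con (ℕtoℚ 5) :* (T :* T) :+ con (ℤ.+ 1 / 20) :* (y :* y) :- y :* φ
        := con (ℕtoℚ 5) :* (T :* T :- φ :* φ)
           :+ con (ℤ.+ 1 / 20) :* ((y :- con (ℕtoℚ 10) :* φ) :* (y :- con (ℕtoℚ 10) :* φ))) refl y (f s) T)

  -- With V ≥ 100 T² the term 5 T² is at most V / 20 as well, so the right side is at most V / 10
  -- and V cancels.
  anticoncentration-spread : ∀ {n} {v : Weights n} → Probability v → 0ℚ <ℚ T → ℕtoℚ 100 * (T * T) ≤ℚ variance v →
    ∫ v (λ x → w (size x)) ≤ℚ ℤ.+ 1 / 10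
  anticoncentration-spread {v = v} P 0<T large = *-cancelˡ
    (ℚₚ.<-≤-trans (0<* {ℕtoℚ 100} (ℚₚ.positive⁻¹ _) (0<* 0<T 0<T)) large)
    (ℚₚ.≤-trans (anticoncentration P (ℚₚ.<⇒≤ 0<T)) (≤-from-diff
      (0≤* {ℤ.+ 1 / 20} (ℚₚ.nonNegative⁻¹ _) (0≤- large))
      (solve 2 (λ V t → V :* con (ℤ.+ 1 / 10) :- (con (ℕtoℚ 5) :* t :+ con (ℤ.+ 1 / 20) :* V)
        := con (ℤ.+ 1 / 20) :* (V :- con (ℕtoℚ 100) :* t)) refl (variance v) (T * T))))

-- Balance, posterior variance and the success at a leaf

balance : ∀ {n} → Weights n → ℚ
balance []            = 1ℚ
balance ((a , b) ∷ v) = ℕtoℚ 4 * (a * b) * balance v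

4ab≤1 : ∀ {a b} → a + b ≡ 1ℚ → ℕtoℚ 4 * (a * b) ≤ℚ 1ℚ
4ab≤1 {a} {b} e = subst (λ z → ℕtoℚ 4 * (a * b) ≤ℚ z * z) e (≤-from-diff (0≤² (a - b))
  (solve 2 (λ a b → (a :+ b) :* (a :+ b) :- con (ℕtoℚ 4) :* (a :* b) := (a :- b) :* (a :- b)) refl a b))

-- The bits are sorted by whether 4 a b reaches δ. Each of the k that do adds at least δ / 4 to the
-- variance. Each of the s others puts a factor below δ into `balance`, whose remaining factors are
-- at most 1.
count-unbalanced : ∀ {n} {v : Weights n} {δ} → Probability v → 0ℚ ≤ℚ δ →
  Σ ℕ λ s → Σ ℕ λ k → s ℕ.+ k ≡ n × δ * ℕtoℚ k ≤ℚ ℕtoℚ 4 * variance v × balance v ≤ℚ δ ^ℚ s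
count-unbalanced {δ = δ} [] 0≤δ = 0 , 0 , refl , ℚₚ.≤-reflexive (ℚₚ.*-zeroʳ δ) , ℚₚ.≤-refl
count-unbalanced {v = (a , b) ∷ v} {δ} (((0≤a , 0≤b) , e) ∷ P) 0≤δ
  with count-unbalanced {δ = δ} P 0≤δ | δ ℚₚ.≤? ℕtoℚ 4 * (a * b)
... | s , k , s+k≡n , δk≤4V , bal | yes δ≤4ab =
  s , suc k , trans (ℕₚ.+-suc s k) (cong suc s+k≡n)
  , subst (λ z → δ * z ≤ℚ ℕtoℚ 4 * (a * b + variance v)) (sym (ℕtoℚ-suc k))
      (≤-from-diff (0≤+ (0≤- δ≤4ab) (0≤- δk≤4V))
        (solve 4 (λ c V δ k → con (ℕtoℚ 4) :* (c :+ V) :- δ :* (k :+ con 1ℚ)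
          := (con (ℕtoℚ 4) :* c :- δ) :+ (con (ℕtoℚ 4) :* V :- δ :* k)) refl (a * b) (variance v) δ (ℕtoℚ k)))
  , subst (balance ((a , b) ∷ v) ≤ℚ_) (ℚₚ.*-identityˡ (δ ^ℚ s))
      (*-mono (0≤* {ℕtoℚ 4} (ℚₚ.nonNegative⁻¹ _) (0≤* 0≤a 0≤b)) (^ℚ≥0 s 0≤δ) (4ab≤1 {a} {b} e) bal)
... | s , k , s+k≡n , δk≤4V , bal | no  δ≰4ab =
  suc s , k , cong suc s+k≡n
  , ℚₚ.≤-trans δk≤4V (*-monoˡ {ℕtoℚ 4} {variance v} {a * b + variance v} (ℚₚ.nonNegative⁻¹ _)
      (≤-from-diff (0≤* 0≤a 0≤b) (solve 2 (λ c V → c :+ V :- V := c) refl (a * b) (variance v))))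
  , *-mono (0≤* {ℕtoℚ 4} (ℚₚ.nonNegative⁻¹ _) (0≤* 0≤a 0≤b)) (^ℚ≥0 s 0≤δ) (ℚₚ.<⇒≤ (ℚₚ.≰⇒> δ≰4ab)) bal

-- Here δ k ≤ 4 V ≤ δ n / 2, so at most half of the bits are balanced and s ≥ n / 2 ≥ h.
small-variance⇒unbalanced : ∀ {n} {v : Weights n} {δ} h → Probability v → 0ℚ <ℚ δ → δ ≤ℚ 1ℚ →
  2 ℕ.* h ≤ n → ℕtoℚ 8 * variance v ≤ℚ δ * ℕtoℚ n → balance v ≤ℚ δ ^ℚ h
small-variance⇒unbalanced {n} {v} {δ} h P 0<δ δ≤1 2h≤n small
  with count-unbalanced {δ = δ} P (ℚₚ.<⇒≤ 0<δ)
... | s , k , s+k≡n , δk≤4V , bal = ℚₚ.≤-trans bal (^ℚ-antimonoʳ (ℚₚ.<⇒≤ 0<δ) δ≤1 h≤s)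
  where
  2k≤n : 2 ℕ.* k ≤ n
  2k≤n = ℕtoℚ-cancel-≤ (subst (_≤ℚ ℕtoℚ n) (sym (ℕtoℚ-* 2 k)) (*-cancelˡ 0<δ (ℚₚ.≤-trans
    (≤-from-diff (0≤* {ℕtoℚ 2} (ℚₚ.nonNegative⁻¹ _) (0≤- δk≤4V))
      (solve 3 (λ δ k V → con (ℕtoℚ 8) :* V :- δ :* (con (ℕtoℚ 2) :* k)
        := con (ℕtoℚ 2) :* (con (ℕtoℚ 4) :* V :- δ :* k)) refl δ (ℕtoℚ k) (variance v)))
    small)))
  h≤s : h ≤ s
  h≤s = ℕₚ.*-cancelˡ-≤ 2 (ℕₚ.≤-trans 2h≤n (ℕₚ.+-cancelʳ-≤ (2 ℕ.* k) n (2 ℕ.* s)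
    (ℕₚ.≤-trans (ℕₚ.+-monoʳ-≤ n 2k≤n) (ℕₚ.≤-reflexive (sym (trans (sym (ℕₚ.*-distribˡ-+ 2 s k))
      (trans (cong (2 ℕ.*_) s+k≡n) (cong (n ℕ.+_) (ℕₚ.+-identityʳ n)))))))))

-- Each pair is normalised on its own; `total v` is the product of the normalising factors.
-- `balance` has degree 2 in every pair, hence the square.
posterior : ∀ {n} {v : Weights n} → PosWeights v → Σ (Weights n) λ p → Probability p ×
  (∀ F → ∫ v F ≡ total v * ∫ p F) × balance v ≡ total v * total v * balance p
posterior [] = [] , [] , (λ F → sym (ℚₚ.*-identityˡ (F []))) , refl
posterior {v = (a , b) ∷ v} ((0<a , 0<b) ∷ pos)
  with posterior pos | inverse (ℚₚ.+-mono-< 0<a 0<b)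
... | p , P , int , bal | r , 0<r , r[a+b]≡1 =
  (r * a , r * b) ∷ p
  , ((0≤* (ℚₚ.<⇒≤ 0<r) (ℚₚ.<⇒≤ 0<a) , 0≤* (ℚₚ.<⇒≤ 0<r) (ℚₚ.<⇒≤ 0<b)) , trans (sym (ℚₚ.*-distribˡ-+ r a b)) r[a+b]≡1) ∷ P
  , (λ F → trans (cong₂ (λ s t → a * s + b * t) (int _) (int _))
      (trans (≡1⇒≡* r[a+b]≡1)
        (solve 6 (λ a b r Z s t → (r :* (a :+ b)) :* (a :* (Z :* s) :+ b :* (Z :* t))
          := ((a :+ b) :* Z) :* ((r :* a) :* s :+ (r :* b) :* t)) refl a b r (total v) _ _)))
  , trans (cong (ℕtoℚ 4 * (a * b) *_) bal) (trans (≡1⇒≡* (cong₂ _*_ r[a+b]≡1 r[a+b]≡1))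
        (solve 5 (λ a b r Z B → (r :* (a :+ b)) :* (r :* (a :+ b)) :* (con (ℕtoℚ 4) :* (a :* b) :* (Z :* Z :* B))
          := ((a :+ b) :* Z) :* ((a :+ b) :* Z) :* (con (ℕtoℚ 4) :* ((r :* a) :* (r :* b)) :* B)) refl a b r (total v) (balance p)))

total≥0 : ∀ {n} {v : Weights n} → NonNegWeights v → 0ℚ ≤ℚ total v
total≥0 []            = ℚₚ.nonNegative⁻¹ 1ℚ
total≥0 ((p , q) ∷ P) = 0≤* (0≤+ p q) (total≥0 P)

infix 9 _³
_³ : ℚ → ℚ
p ³ = p * p * p

0≤³ : ∀ {p} → 0ℚ ≤ℚ p → 0ℚ ≤ℚ p ³
0≤³ 0≤p = 0≤* (0≤* 0≤p 0≤p) 0≤p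

-- If the posterior variance is at least 100 T², anticoncentration yields the first term. Otherwise
-- `balance p` is at most δ^h; since `total v ³ * g` is `total v` divided by `balance p`, the second
-- term alone is at least `total v`, the trivial bound. This is Markov's inequality for the
-- reciprocal of the balance.
leaf-bound : ∀ {n} {v : Weights n} {T r w δ g} h → SupportedNear T r w → PosWeights v →
  0ℚ <ℚ T → 0ℚ <ℚ δ → δ ≤ℚ 1ℚ → 2 ℕ.* h ≤ n → ℕtoℚ 800 * (T * T) ≤ℚ δ * ℕtoℚ n →
  0ℚ ≤ℚ g → g * balance v ≡ 1ℚ →
  ∫ v (λ x → w (size x)) ≤ℚ ℤ.+ 1 / 10 * total v + total v ³ * g * δ ^ℚ h
leaf-bound {n} {v} {T} {r} {w} {δ} {g} h near pos 0<T 0<δ δ≤1 2h≤n 800T²≤δn 0≤g g·bal≡1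
  with posterior pos
... | p , P , int , bal = subst (_≤ℚ ℤ.+ 1 / 10 * Z + Z ³ * g * δ ^ℚ h) (sym (int _)) bound
  where
  Z I : ℚ
  Z = total v
  I = ∫ p (λ x → w (size x))
  0≤Z : 0ℚ ≤ℚ Z
  0≤Z = total≥0 (pos⇒nonNeg pos)
  w≤1 : ∀ y → w y ≤ℚ 1ℚ
  w≤1 y with near y
  ... | inj₁ w≤0       = ℚₚ.≤-trans w≤0 (ℚₚ.nonNegative⁻¹ 1ℚ)
  ... | inj₂ (w≤1 , _) = w≤1
  I≤1 : I ≤ℚ 1ℚ
  I≤1 = subst (I ≤ℚ_) (trans (∫-1 p) (total-prob P)) (∫-mono (prob⇒nonNeg P) (λ x → w≤1 (size x)))
  bound : Z * I ≤ℚ ℤ.+ 1 / 10 * Z + Z ³ * g * δ ^ℚ h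
  bound with ℕtoℚ 100 * (T * T) ℚₚ.≤? variance p
  ... | yes spread = ≤-from-diff
    (0≤+ (0≤* 0≤Z (0≤- (anticoncentration-spread near P 0<T spread)))
         (0≤* (0≤* (0≤³ 0≤Z) 0≤g) (^ℚ≥0 h (ℚₚ.<⇒≤ 0<δ))))
    (solve 3 (λ Z I X → con (ℤ.+ 1 / 10) :* Z :+ X :- Z :* I := Z :* (con (ℤ.+ 1 / 10) :- I) :+ X)
      refl Z I (Z ³ * g * δ ^ℚ h))
  ... | no  concentrated = ≤-from-diff
    (0≤+ (0≤+ (0≤* 0≤Z (0≤- I≤1)) (0≤* (0≤* (0≤³ 0≤Z) 0≤g) (0≤- unbalanced)))
         (0≤* {ℤ.+ 1 / 10} (ℚₚ.nonNegative⁻¹ _) 0≤Z))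
    -- Zero is added as `Z - Z` and only its second copy is rewritten by `mass`; this brings in that
    -- `g` inverts `balance v`.
    (trans (solve 2 (λ X Z → X := X :+ (Z :- Z)) refl (ℤ.+ 1 / 10 * Z + Z ³ * g * δ ^ℚ h - Z * I) Z)
    (trans (cong (λ z → ℤ.+ 1 / 10 * Z + Z ³ * g * δ ^ℚ h - Z * I + (Z - z)) (sym mass))
           (solve 5 (λ Z I g D B → con (ℤ.+ 1 / 10) :* Z :+ Z :* Z :* Z :* g :* D :- Z :* I
               :+ (Z :- Z :* (g :* (Z :* Z :* B)))
             := Z :* (con 1ℚ :- I) :+ Z :* Z :* Z :* g :* (D :- B) :+ con (ℤ.+ 1 / 10) :* Z)
             refl Z I g (δ ^ℚ h) (balance p))))
    where
    unbalanced : balance p ≤ℚ δ ^ℚ h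
    unbalanced = small-variance⇒unbalanced h P 0<δ δ≤1 2h≤n (ℚₚ.≤-trans
      (≤-from-diff (0≤* {ℕtoℚ 8} (ℚₚ.nonNegative⁻¹ _) (0≤- (ℚₚ.<⇒≤ (ℚₚ.≰⇒> concentrated))))
        (solve 2 (λ V t → con (ℕtoℚ 800) :* t :- con (ℕtoℚ 8) :* V := con (ℕtoℚ 8) :* (con (ℕtoℚ 100) :* t :- V))
          refl (variance p) (T * T)))
      800T²≤δn)
    mass : Z * (g * (Z * Z * balance p)) ≡ Z
    mass = trans (cong (λ z → Z * (g * z)) (sym bal)) (trans (cong (Z *_) g·bal≡1) (ℚₚ.*-identityʳ Z))

-- Decision trees

scale : ℚ → ℚ → ℚ × ℚ → ℚ × ℚ
scale c d (a , b) = c * a , d * b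

-- The unnormalised Bayesian update: `c` and `d` are the likelihoods of the answer when bit `i` is
-- set and when it is not.
scaleAt : ∀ {n} → Weights n → Fin n → ℚ → ℚ → Weights n
scaleAt v i c d = updateAt v i (scale c d)

scaleAt-pos : ∀ {n} {v : Weights n} {c d} → PosWeights v → ∀ i → 0ℚ <ℚ c → 0ℚ <ℚ d → PosWeights (scaleAt v i c d)
scaleAt-pos ((p , q) ∷ P) zero    0<c 0<d = (0<* 0<c p , 0<* 0<d q) ∷ P
scaleAt-pos (pq ∷ P)      (suc i) 0<c 0<d = pq ∷ scaleAt-pos P i 0<c 0<d

∫-scaleAt : ∀ {n} (v : Weights n) i c d F →
  ∫ (scaleAt v i c d) F ≡ ∫ v (λ x → (if lookup x i then c else d) * F x)
∫-scaleAt ((a , b) ∷ v) zero c d F = trans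
  (solve 6 (λ a b c d s t → (c :* a) :* s :+ (d :* b) :* t := a :* (c :* s) :+ b :* (d :* t)) refl a b c d _ _)
  (sym (cong₂ (λ s t → a * s + b * t) (∫-*ˡ v c _) (∫-*ˡ v d _)))
∫-scaleAt ((a , b) ∷ v) (suc i) c d F =
  cong₂ (λ s t → a * s + b * t) (∫-scaleAt v i c d _) (∫-scaleAt v i c d _)

balance-scaleAt : ∀ {n} (v : Weights n) i c d → balance (scaleAt v i c d) ≡ c * d * balance v
balance-scaleAt ((a , b) ∷ v) zero c d =
  solve 5 (λ a b c d B → con (ℕtoℚ 4) :* ((c :* a) :* (d :* b)) :* B := c :* d :* (con (ℕtoℚ 4) :* (a :* b) :* B))
    refl a b c d (balance v)
balance-scaleAt ((a , b) ∷ v) (suc i) c d = trans (cong (ℕtoℚ 4 * (a * b) *_) (balance-scaleAt v i c d))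
  (solve 4 (λ u c d B → u :* (c :* d :* B) := c :* d :* (u :* B)) refl (ℕtoℚ 4 * (a * b)) c d (balance v))

total-split : ∀ {n} (v : Weights n) i {c d} → c + d ≡ 1ℚ →
  total (scaleAt v i c d) + total (scaleAt v i d c) ≡ total v
total-split ((a , b) ∷ v) zero {c} {d} e = trans
  (solve 5 (λ a b c d Z → (c :* a :+ d :* b) :* Z :+ (d :* a :+ c :* b) :* Z := (c :+ d) :* ((a :+ b) :* Z))
    refl a b c d (total v))
  (sym (≡1⇒≡* e))
total-split ((a , b) ∷ v) (suc i) {c} {d} e =
  trans (sym (ℚₚ.*-distribˡ-+ (a + b) (total (scaleAt v i c d)) _)) (cong ((a + b) *_) (total-split v i {c} {d} e))

-- Up to the factor of the other bits, put u = a + b, s = c a + d b and t = d a + c b. Then s + t =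
-- u, so s³ + t³ = u³ - 3 s t u, and s t = c d u² + a b (c - d)² ≥ c d u².
total³-split : ∀ {n} {v : Weights n} → NonNegWeights v → ∀ i {c d} → c + d ≡ 1ℚ →
  total (scaleAt v i c d) ³ + total (scaleAt v i d c) ³ ≤ℚ (1ℚ - ℕtoℚ 3 * (c * d)) * total v ³
total³-split {v = (a , b) ∷ v} ((0≤a , 0≤b) ∷ P) zero {c} {d} e =
  ≤-from-diff
    (0≤* (0≤* {ℕtoℚ 3} (ℚₚ.nonNegative⁻¹ _) (0≤* (0≤* (0≤+ 0≤a 0≤b) (0≤* 0≤a 0≤b)) (0≤² (c - d))))
         (0≤³ (total≥0 P)))
    -- The identity holds only for c + d = 1, so it is proved with 1 - c in place of d and
    -- transported.
    (subst (λ d → (1ℚ - ℕtoℚ 3 * (c * d)) * total ((a , b) ∷ v) ³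
                  - (total (scaleAt ((a , b) ∷ v) zero c d) ³ + total (scaleAt ((a , b) ∷ v) zero d c) ³)
                ≡ ℕtoℚ 3 * ((a + b) * (a * b) * ((c - d) * (c - d))) * total v ³)
      (sym (trans (solve 2 (λ c d → d := (c :+ d) :- c) refl c d) (cong (_- c) e)))
      (identity a b c (total v)))
  where
  identity : ∀ a b c Z →
    (1ℚ - ℕtoℚ 3 * (c * (1ℚ - c))) * ((a + b) * Z) ³
      - (((c * a + (1ℚ - c) * b) * Z) ³ + (((1ℚ - c) * a + c * b) * Z) ³)
    ≡ ℕtoℚ 3 * ((a + b) * (a * b) * ((c - (1ℚ - c)) * (c - (1ℚ - c)))) * Z ³
  identity = solve 4 (λ a b c Z →
    let d = con 1ℚ :- c ; u = (a :+ b) :* Z ; s = (c :* a :+ d :* b) :* Z ; t = (d :* a :+ c :* b) :* Z in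
    (con 1ℚ :- con (ℕtoℚ 3) :* (c :* d)) :* (u :* u :* u) :- (s :* s :* s :+ t :* t :* t)
    := con (ℕtoℚ 3) :* ((a :+ b) :* (a :* b) :* ((c :- d) :* (c :- d))) :* (Z :* Z :* Z)) refl
total³-split {v = (a , b) ∷ v} ((0≤a , 0≤b) ∷ P) (suc i) {c} {d} e = ≤-from-diff
  (0≤* (0≤³ (0≤+ 0≤a 0≤b)) (0≤- (total³-split P i {c} {d} e)))
  (solve 5 (λ u k Z s t → k :* ((u :* Z) :* (u :* Z) :* (u :* Z))
      :- ((u :* s) :* (u :* s) :* (u :* s) :+ (u :* t) :* (u :* t) :* (u :* t))
    := u :* u :* u :* (k :* (Z :* Z :* Z) :- (s :* s :* s :+ t :* t :* t)))
    refl (a + b) (1ℚ - ℕtoℚ 3 * (c * d)) (total v) (total (scaleAt v i c d)) (total (scaleAt v i d c)))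

answerChance : ℚ → ℚ → ∀ {n} → Input n → Fin n → Bool → ℚ
answerChance α β x i answer = if does (answer ≟ᵇ lookup x i) then α else β

-- The rational counterpart of `successProbability`, with chances `α` of a correct and `β` of a
-- wrong answer.
chance : ℚ → ℚ → ∀ {n} → Input n → DecisionTree n → ℚ
chance α β x (output r)  = if does (isApproximation? x r) then 1ℚ else 0ℚ
chance α β x (query i t) =
  answerChance α β x i true * chance α β x (t true) + answerChance α β x i false * chance α β x (t false)

-- The likelihood of each answer depends on bit `i` alone, so it is absorbed into the weights and
-- the measure remains a product.
∫-query : ∀ {n} (v : Weights n) α β i t →
  ∫ v (λ x → chance α β x (query i t)) ≡
  ∫ (scaleAt v i α β) (λ x → chance α β x (t true)) + ∫ (scaleAt v i β α) (λ x → chance α β x (t false))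
∫-query v α β i t = trans (∫-+ v _ _) (cong₂ _+_
  (trans (∫-cong v (λ x → cong (_* chance α β x (t true)) (answer-true x))) (sym (∫-scaleAt v i α β _)))
  (trans (∫-cong v (λ x → cong (_* chance α β x (t false)) (answer-false x))) (sym (∫-scaleAt v i β α _))))
  where
  answer-true : ∀ x → answerChance α β x i true ≡ (if lookup x i then α else β)
  answer-true x with lookup x i
  ... | true  = refl
  ... | false = refl
  answer-false : ∀ x → answerChance α β x i false ≡ (if lookup x i then β else α)
  answer-false x with lookup x i
  ... | true  = refl
  ... | false = refl

record Channel : Set where
  field
    α β κ₀ : ℚ
    0<α    : 0ℚ <ℚ α
    0<β    : 0ℚ <ℚ β
    α+β≡1  : α + β ≡ 1ℚ
    0≤κ₀   : 0ℚ ≤ℚ κ₀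
    κ₀αβ≡1 : κ₀ * (α * β) ≡ 1ℚ
    4≤κ₀   : ℕtoℚ 4 ≤ℚ κ₀

  -- A query multiplies `g` by `κ₀`, while the cubes of the two new totals sum to at most 1 - 3 α β
  -- times the old cube; κ₀ (1 - 3 α β) = κ₀ - 3.
  κ : ℚ
  κ = κ₀ - ℕtoℚ 3

-- If g * balance v ≡ 1, then total v ³ * g is the probability of reaching the
-- state v divided by ∏ᵢ 4 pᵢ (1 - pᵢ), where p is the posterior; a query increases
-- the expectation of the reciprocal of that product at most by the factor κ.
module _ (C : Channel) {n : ℕ} {b : ℚ} (0≤b : 0ℚ ≤ℚ b) where
  open Channel C

  LeafBound : Set
  LeafBound = ∀ {v : Weights n} {g} → PosWeights v → 0ℚ ≤ℚ g → g * balance v ≡ 1ℚ → ∀ r →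
    ∫ v (λ x → chance α β x (output r)) ≤ℚ ℤ.+ 1 / 10 * total v + total v ³ * g * b

  1≤κ : 1ℚ ≤ℚ κ
  1≤κ = ≤-from-diff (0≤- 4≤κ₀)
    (solve 1 (λ k → k :- con (ℕtoℚ 3) :- con 1ℚ := k :- con (ℕtoℚ 4)) refl κ₀)

  tree-bound : LeafBound → ∀ q (t : DecisionTree n) → depth t ≤ q →
    ∀ {v : Weights n} {g} → PosWeights v → 0ℚ ≤ℚ g → g * balance v ≡ 1ℚ →
    ∫ v (λ x → chance α β x t) ≤ℚ ℤ.+ 1 / 10 * total v + κ ^ℚ q * (total v ³ * g * b)
  tree-bound leaf q (output r) _ {v} {g} pos 0≤g g·bal≡1 = ℚₚ.≤-trans (leaf pos 0≤g g·bal≡1 r)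
    (≤-from-diff
      (0≤* (0≤- (1≤^ℚ q 1≤κ)) (0≤* (0≤* (0≤³ (total≥0 (pos⇒nonNeg pos))) 0≤g) 0≤b))
      (solve 3 (λ Z k H → Z :+ k :* H :- (Z :+ H) := (k :- con 1ℚ) :* H)
        refl (ℤ.+ 1 / 10 * total v) (κ ^ℚ q) (total v ³ * g * b)))
  tree-bound leaf (suc q) (query i t) (ℕ.s≤s d) {v} {g} pos 0≤g g·bal≡1 =
    subst (_≤ℚ ℤ.+ 1 / 10 * total v + κ ^ℚ suc q * (total v ³ * g * b)) (sym (∫-query v α β i t))
      (ℚₚ.≤-trans (ℚₚ.+-mono-≤
          (tree-bound leaf q (t true) (ℕₚ.m⊔n≤o⇒m≤o _ _ d) (scaleAt-pos pos i 0<α 0<β) 0≤g′ (g′·bal α β refl))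
          (tree-bound leaf q (t false) (ℕₚ.m⊔n≤o⇒n≤o _ _ d) (scaleAt-pos pos i 0<β 0<α) 0≤g′ (g′·bal β α (ℚₚ.*-comm β α))))
        (≤-from-diff
          (0≤* (0≤* (0≤* (0≤* (^ℚ≥0 q (ℚₚ.≤-trans (ℚₚ.nonNegative⁻¹ 1ℚ) 1≤κ)) 0≤κ₀) 0≤g) 0≤b)
               (0≤- (total³-split (pos⇒nonNeg pos) i {α} {β} α+β≡1)))
          -- The terms in 1/10 cancel because the totals add up; the rest is a multiple of the slack
          -- in `total³-split`.
          (trans (cong₂ (λ z k → ℤ.+ 1 / 10 * z + k * κ ^ℚ q * (total v ³ * g * b) - (R₁ + R₂)) (sym (total-split v i {α} {β} α+β≡1)) κ-step)
            (solve 8 (λ s t K k g b Z c →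
              con (ℤ.+ 1 / 10) :* (s :+ t) :+ k :* (con 1ℚ :- con (ℕtoℚ 3) :* c) :* K :* (Z :* g :* b)
                :- ((con (ℤ.+ 1 / 10) :* s :+ K :* (s :* s :* s :* (k :* g) :* b))
                   :+ (con (ℤ.+ 1 / 10) :* t :+ K :* (t :* t :* t :* (k :* g) :* b)))
              := K :* k :* g :* b :* ((con 1ℚ :- con (ℕtoℚ 3) :* c) :* Z :- (s :* s :* s :+ t :* t :* t)))
              refl (total v₁) (total v₂) (κ ^ℚ q) κ₀ g b (total v ³) (α * β)))))
    where
    v₁ v₂ : Weights n
    v₁ = scaleAt v i α β
    v₂ = scaleAt v i β α
    R₁ R₂ : ℚ
    R₁ = ℤ.+ 1 / 10 * total v₁ + κ ^ℚ q * (total v₁ ³ * (κ₀ * g) * b)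
    R₂ = ℤ.+ 1 / 10 * total v₂ + κ ^ℚ q * (total v₂ ³ * (κ₀ * g) * b)
    0≤g′ : 0ℚ ≤ℚ κ₀ * g
    0≤g′ = 0≤* 0≤κ₀ 0≤g
    g′·bal : ∀ c d → c * d ≡ α * β → κ₀ * g * balance (scaleAt v i c d) ≡ 1ℚ
    g′·bal c d cd≡αβ = trans (cong (κ₀ * g *_) (trans (balance-scaleAt v i c d) (cong (_* balance v) cd≡αβ)))
      (trans (solve 4 (λ k g c B → k :* g :* (c :* B) := (k :* c) :* (g :* B)) refl κ₀ g (α * β) (balance v))
        (cong₂ _*_ κ₀αβ≡1 g·bal≡1))
    κ-step : κ ≡ κ₀ * (1ℚ - ℕtoℚ 3 * (α * β))
    κ-step = trans (cong (λ z → κ₀ - ℕtoℚ 3 * z) (sym κ₀αβ≡1))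
      (solve 2 (λ k c → k :- con (ℕtoℚ 3) :* (k :* c) := k :* (con 1ℚ :- con (ℕtoℚ 3) :* c)) refl κ₀ (α * β))

^ℚ-assoc : ∀ p m n → (p ^ℚ m) ^ℚ n ≡ p ^ℚ (m ℕ.* n)
^ℚ-assoc = Exp.^-assocʳ

-- Numerical estimates

bernoulli : ∀ {y} k → 0ℚ ≤ℚ y → 1ℚ + ℕtoℚ k * y ≤ℚ (1ℚ + y) ^ℚ k
bernoulli {y} zero    0≤y = ℚₚ.≤-reflexive (trans (cong (1ℚ +_) (ℚₚ.*-zeroˡ y)) (ℚₚ.+-identityʳ 1ℚ))
bernoulli {y} (suc k) 0≤y = subst (λ z → 1ℚ + z * y ≤ℚ (1ℚ + y) ^ℚ suc k) (sym (ℕtoℚ-suc k))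
  (≤-from-diff
    (0≤+ (0≤* (0≤+ (ℚₚ.nonNegative⁻¹ 1ℚ) 0≤y) (0≤- (bernoulli k 0≤y))) (0≤* (ℕtoℚ≥0 k) (0≤² y)))
    (solve 3 (λ k y P → (con 1ℚ :+ y) :* P :- (con 1ℚ :+ (k :+ con 1ℚ) :* y)
      := (con 1ℚ :+ y) :* (P :- (con 1ℚ :+ k :* y)) :+ k :* (y :* y)) refl (ℕtoℚ k) y ((1ℚ + y) ^ℚ k)))

-- The left side decreases in q, since (1 + y) (1 - (q + 1) y) = 1 - q y - (q + 1) y².
bernoulli⁻¹ : ∀ {y} q → 0ℚ ≤ℚ y → (1ℚ + y) ^ℚ q * (1ℚ - ℕtoℚ q * y) ≤ℚ 1ℚ
bernoulli⁻¹ {y} zero    0≤y = ℚₚ.≤-reflexive (solve 1 (λ y → con 1ℚ :* (con 1ℚ :- con 0ℚ :* y) := con 1ℚ) refl y)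
bernoulli⁻¹ {y} (suc q) 0≤y = ℚₚ.≤-trans
  (subst (λ z → (1ℚ + y) ^ℚ suc q * (1ℚ - z * y) ≤ℚ (1ℚ + y) ^ℚ q * (1ℚ - ℕtoℚ q * y)) (sym (ℕtoℚ-suc q))
    (≤-from-diff
      (0≤* (^ℚ≥0 q (0≤+ (ℚₚ.nonNegative⁻¹ 1ℚ) 0≤y)) (0≤* (0≤+ (ℕtoℚ≥0 q) (ℚₚ.nonNegative⁻¹ 1ℚ)) (0≤² y)))
      (solve 3 (λ q y P → P :* (con 1ℚ :- q :* y) :- (con 1ℚ :+ y) :* P :* (con 1ℚ :- (q :+ con 1ℚ) :* y)
        := P :* ((q :+ con 1ℚ) :* (y :* y))) refl (ℕtoℚ q) y ((1ℚ + y) ^ℚ q))))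
  (bernoulli⁻¹ q 0≤y)

[1+y]^q≤2 : ∀ {y} q → 0ℚ ≤ℚ y → ℕtoℚ 2 * (ℕtoℚ q * y) ≤ℚ 1ℚ → (1ℚ + y) ^ℚ q ≤ℚ ℕtoℚ 2
[1+y]^q≤2 {y} q 0≤y 2qy≤1 = ≤-from-diff
  (0≤+ (0≤* {ℕtoℚ 2} (ℚₚ.nonNegative⁻¹ _) (0≤- (bernoulli⁻¹ q 0≤y)))
       (0≤* (^ℚ≥0 q (0≤+ (ℚₚ.nonNegative⁻¹ 1ℚ) 0≤y)) (0≤- 2qy≤1)))
  (solve 2 (λ u P → con (ℕtoℚ 2) :- P
    := con (ℕtoℚ 2) :* (con 1ℚ :- P :* (con 1ℚ :- u)) :+ P :* (con 1ℚ :- con (ℕtoℚ 2) :* u))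
    refl (ℕtoℚ q * y) ((1ℚ + y) ^ℚ q))

-- Takes the place of (1 + x)^q ≤ e^(q x). With y = x / k, Bernoulli gives 1 + x ≤ (1 + y)^k; after
-- exchanging the exponents, q y ≤ 1/2 gives (1 + y)^q ≤ 2.
[1+x]^q≤2^k : ∀ {x} q k → 0ℚ ≤ℚ x → 1 ≤ k → ℕtoℚ 2 * (ℕtoℚ q * x) ≤ℚ ℕtoℚ k → (1ℚ + x) ^ℚ q ≤ℚ ℕtoℚ 2 ^ℚ k
[1+x]^q≤2^k {x} q k 0≤x 1≤k 2qx≤k = begin
  (1ℚ + x) ^ℚ q              ≤⟨ ^ℚ-monoˡ q (0≤+ (ℚₚ.nonNegative⁻¹ 1ℚ) 0≤x) 1+x≤[1+y]^k ⟩
  ((1ℚ + y) ^ℚ k) ^ℚ q       ≡⟨ ^ℚ-assoc (1ℚ + y) k q ⟩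
  (1ℚ + y) ^ℚ (k ℕ.* q)      ≡⟨ cong ((1ℚ + y) ^ℚ_) (ℕₚ.*-comm k q) ⟩
  (1ℚ + y) ^ℚ (q ℕ.* k)      ≡⟨ ^ℚ-assoc (1ℚ + y) q k ⟨
  ((1ℚ + y) ^ℚ q) ^ℚ k       ≤⟨ ^ℚ-monoˡ k (^ℚ≥0 q (0≤+ (ℚₚ.nonNegative⁻¹ 1ℚ) 0≤y)) ([1+y]^q≤2 q 0≤y 2qy≤1) ⟩
  ℕtoℚ 2 ^ℚ k                ∎
  where
  open ℚₚ.≤-Reasoning
  k⁻¹ : Σ ℚ λ r → 0ℚ <ℚ r × r * ℕtoℚ k ≡ 1ℚ
  k⁻¹ = inverse (ℚₚ.<-≤-trans (ℚₚ.positive⁻¹ 1ℚ) (ℕtoℚ-mono 1≤k))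
  r : ℚ
  r = proj₁ k⁻¹
  0<r : 0ℚ <ℚ r
  0<r = proj₁ (proj₂ k⁻¹)
  rk≡1 : r * ℕtoℚ k ≡ 1ℚ
  rk≡1 = proj₂ (proj₂ k⁻¹)
  y : ℚ
  y = r * x
  0≤y : 0ℚ ≤ℚ y
  0≤y = 0≤* (ℚₚ.<⇒≤ 0<r) 0≤x
  ky≡x : ℕtoℚ k * y ≡ x
  ky≡x = trans (solve 3 (λ k r x → k :* (r :* x) := r :* k :* x) refl (ℕtoℚ k) r x) (sym (≡1⇒≡* rk≡1))
  1+x≤[1+y]^k : 1ℚ + x ≤ℚ (1ℚ + y) ^ℚ k
  1+x≤[1+y]^k = subst (λ z → 1ℚ + z ≤ℚ (1ℚ + y) ^ℚ k) ky≡x (bernoulli k 0≤y)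
  2qy≤1 : ℕtoℚ 2 * (ℕtoℚ q * y) ≤ℚ 1ℚ
  2qy≤1 = subst₂ _≤ℚ_
    (solve 3 (λ q r x → r :* (con (ℕtoℚ 2) :* (q :* x)) := con (ℕtoℚ 2) :* (q :* (r :* x))) refl (ℕtoℚ q) r x)
    rk≡1 (*-monoˡ (ℚₚ.<⇒≤ 0<r) 2qx≤k)

^ℚ-mono-< : ∀ {p q} n → 0ℚ ≤ℚ p → p <ℚ q → p ^ℚ suc n <ℚ q ^ℚ suc n
^ℚ-mono-< {p} {q} zero    0≤p p<q = subst₂ _<ℚ_ (sym (ℚₚ.*-identityʳ p)) (sym (ℚₚ.*-identityʳ q)) p<q
^ℚ-mono-< {p} {q} (suc n) 0≤p p<q = ℚₚ.≤-<-trans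
  (*-monoʳ (^ℚ≥0 (suc n) 0≤p) (ℚₚ.<⇒≤ p<q))
  (ℚₚ.*-monoʳ-<-pos q {{ℚ.positive (ℚₚ.≤-<-trans 0≤p p<q)}} (^ℚ-mono-< n 0≤p p<q))

p≤∣p∣ : ∀ p → p ≤ℚ ℚ.∣ p ∣
p≤∣p∣ p with ℚₚ.≤-total 0ℚ p
... | inj₁ 0≤p = ℚₚ.≤-reflexive (sym (ℚₚ.0≤p⇒∣p∣≡p 0≤p))
... | inj₂ p≤0 = ℚₚ.≤-trans p≤0 (ℚₚ.0≤∣p∣ p)

-- Binary logarithms and the choice of parameters

n≤2^⌈log₂n⌉ : ∀ n → n ≤ 2 ℕ.^ ⌈log₂ n ⌉
n≤2^⌈log₂n⌉ = <-rec _ step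
  where
  step : ∀ n → (∀ {m} → m ℕ.< n → m ≤ 2 ℕ.^ ⌈log₂ m ⌉) → n ≤ 2 ℕ.^ ⌈log₂ n ⌉
  step 0 _ = ℕ.z≤n
  step 1 _ = ℕₚ.≤-refl
  step n@(suc (suc n-2)) rec = begin
    n                              ≡⟨ ℕₚ.⌊n/2⌋+⌈n/2⌉≡n n ⟨
    ℕ.⌊ n /2⌋ ℕ.+ ℕ.⌈ n /2⌉        ≤⟨ ℕₚ.+-monoˡ-≤ ℕ.⌈ n /2⌉ (ℕₚ.⌊n/2⌋≤⌈n/2⌉ n) ⟩
    ℕ.⌈ n /2⌉ ℕ.+ ℕ.⌈ n /2⌉        ≡⟨ cong (ℕ.⌈ n /2⌉ ℕ.+_) (ℕₚ.+-identityʳ ℕ.⌈ n /2⌉) ⟨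
    2 ℕ.* ℕ.⌈ n /2⌉                ≤⟨ ℕₚ.*-monoʳ-≤ 2 (rec (ℕₚ.⌈n/2⌉<n n-2)) ⟩
    2 ℕ.* 2 ℕ.^ ⌈log₂ ℕ.⌈ n /2⌉ ⌉  ≡⟨ cong (λ k → 2 ℕ.^ suc k) (⌈log₂⌈n/2⌉⌉≡⌈log₂n⌉∸1 n) ⟩
    2 ℕ.^ suc (⌈log₂ n ⌉ ℕ.∸ 1)    ≡⟨ cong (2 ℕ.^_) (ℕₚ.m+[n∸m]≡n (⌈log₂⌉-mono-≤ {2} {n} (ℕ.s≤s (ℕ.s≤s ℕ.z≤n)))) ⟩
    2 ℕ.^ ⌈log₂ n ⌉                ∎
    where open ℕₚ.≤-Reasoning

2^⌈log₂n⌉≤2n : ∀ n → 1 ≤ n → 2 ℕ.^ ⌈log₂ n ⌉ ≤ 2 ℕ.* n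
2^⌈log₂n⌉≤2n n 1≤n with ⌈log₂ n ⌉ in eq
... | zero  = ℕₚ.≤-trans 1≤n (ℕₚ.m≤m+n n _)
... | suc k with 2 ℕ.^ k ℕₚ.≤? n
...   | yes 2^k≤n = ℕₚ.*-monoʳ-≤ 2 2^k≤n
...   | no  2^k≰n = contradiction
  (subst₂ _≤_ eq (⌈log₂2^n⌉≡n k) (⌈log₂⌉-mono-≤ (ℕₚ.<⇒≤ (ℕₚ.≰⇒> 2^k≰n)))) ℕₚ.1+n≰n

2^k≤n⇒k≤⌈log₂n⌉ : ∀ k {n} → 2 ℕ.^ k ≤ n → k ≤ ⌈log₂ n ⌉
2^k≤n⇒k≤⌈log₂n⌉ k {n} 2^k≤n = subst (_≤ ⌈log₂ n ⌉) (⌈log₂2^n⌉≡n k) (⌈log₂⌉-mono-≤ 2^k≤n)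

-- Here m = ⌊⌈log₂ n⌉ / 8⌋ and h = ⌊n / 2⌋, so that 2 ^ m stands for n^(1/8) and
-- 2 ^ (3 m + 3) for an upper bound of the admissible error n^(3/8) / 40.
record Scale (n : ℕ) : Set where
  field
    m h    : ℕ
    17≤m   : 17 ≤ m
    5≤h    : 5 ≤ h
    2h≤n   : 2 ℕ.* h ≤ n
    n³≤    : n ℕ.^ 3 ≤ (2 ℕ.^ (3 ℕ.* m ℕ.+ 3)) ℕ.^ 8
    ≤n     : 800 ℕ.* (2 ℕ.^ (3 ℕ.* m ℕ.+ 3) ℕ.* 2 ℕ.^ (3 ℕ.* m ℕ.+ 3)) ℕ.* 2 ℕ.^ m ≤ n
    nlogn≤ : n ℕ.* ⌈log₂ n ⌉ ≤ 54 ℕ.* (ℕ.pred m ℕ.* h)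

n^a≤2^e^b : ∀ {n L} a b e → n ≤ 2 ℕ.^ L → L ℕ.* a ≤ e ℕ.* b → n ℕ.^ a ≤ (2 ℕ.^ e) ℕ.^ b
n^a≤2^e^b {n} {L} a b e n≤2^L La≤eb = begin
  n ℕ.^ a           ≤⟨ ℕₚ.^-monoˡ-≤ a n≤2^L ⟩
  (2 ℕ.^ L) ℕ.^ a   ≡⟨ ℕₚ.^-*-assoc 2 L a ⟩
  2 ℕ.^ (L ℕ.* a)   ≤⟨ ℕₚ.^-monoʳ-≤ 2 La≤eb ⟩
  2 ℕ.^ (e ℕ.* b)   ≡⟨ ℕₚ.^-*-assoc 2 e b ⟨
  (2 ℕ.^ e) ℕ.^ b   ∎
  where open ℕₚ.≤-Reasoning

c2^e2^e2^m≤n : ∀ {n L c} k e m → c ≤ 2 ℕ.^ k → 2 ℕ.^ L ≤ 2 ℕ.* n → suc (k ℕ.+ (e ℕ.+ e) ℕ.+ m) ≤ L →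
  c ℕ.* (2 ℕ.^ e ℕ.* 2 ℕ.^ e) ℕ.* 2 ℕ.^ m ≤ n
c2^e2^e2^m≤n {n} {L} {c} k e m c≤2^k 2^L≤2n exponents = ℕₚ.*-cancelˡ-≤ 2 (begin
  2 ℕ.* (c ℕ.* (2 ℕ.^ e ℕ.* 2 ℕ.^ e) ℕ.* 2 ℕ.^ m)
    ≤⟨ ℕₚ.*-monoʳ-≤ 2 (ℕₚ.*-monoˡ-≤ (2 ℕ.^ m) (ℕₚ.*-monoˡ-≤ (2 ℕ.^ e ℕ.* 2 ℕ.^ e) c≤2^k)) ⟩
  2 ℕ.* (2 ℕ.^ k ℕ.* (2 ℕ.^ e ℕ.* 2 ℕ.^ e) ℕ.* 2 ℕ.^ m)
    ≡⟨ cong (λ z → 2 ℕ.* (2 ℕ.^ k ℕ.* z ℕ.* 2 ℕ.^ m)) (ℕₚ.^-distribˡ-+-* 2 e e) ⟨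
  2 ℕ.* (2 ℕ.^ k ℕ.* 2 ℕ.^ (e ℕ.+ e) ℕ.* 2 ℕ.^ m)
    ≡⟨ cong (λ z → 2 ℕ.* (z ℕ.* 2 ℕ.^ m)) (ℕₚ.^-distribˡ-+-* 2 k (e ℕ.+ e)) ⟨
  2 ℕ.* (2 ℕ.^ (k ℕ.+ (e ℕ.+ e)) ℕ.* 2 ℕ.^ m)
    ≡⟨ cong (2 ℕ.*_) (ℕₚ.^-distribˡ-+-* 2 (k ℕ.+ (e ℕ.+ e)) m) ⟨
  2 ℕ.^ suc (k ℕ.+ (e ℕ.+ e) ℕ.+ m)
    ≤⟨ ℕₚ.^-monoʳ-≤ 2 exponents ⟩
  2 ℕ.^ L
    ≤⟨ 2^L≤2n ⟩
  2 ℕ.* n ∎)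
  where open ℕₚ.≤-Reasoning

-- The threshold is 136 = 8 · 17. With 800 ≤ 2^10 and 2^L ≤ 2 n, the bound `≤n` asks for 1 + 10 + 2
-- (3 m + 3) + m = 17 + 7 m ≤ L, and m ≥ 17 makes the left side at most 8 m ≤ L.
mkScale : ∀ n → 2 ℕ.^ 136 ≤ n → Scale n
mkScale n 2^136≤n = record
  { m = m ; h = h ; 17≤m = 17≤m ; 5≤h = 5≤h ; 2h≤n = 2h≤n ; n³≤ = n³≤ ; ≤n = ≤n ; nlogn≤ = nlogn≤ }
  where
  open ℕₚ.≤-Reasoning
  L m h : ℕ
  L = ⌈log₂ n ⌉
  m = L ℕ./ 8
  h = n ℕ./ 2
  136≤L : 136 ≤ L
  136≤L = 2^k≤n⇒k≤⌈log₂n⌉ 136 2^136≤n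
  L≡ : L ≡ L ℕ.% 8 ℕ.+ m ℕ.* 8
  L≡ = m≡m%n+[m/n]*n L 8
  L<8m+8 : L ℕ.< 8 ℕ.+ m ℕ.* 8
  L<8m+8 = subst (ℕ._< 8 ℕ.+ m ℕ.* 8) (sym L≡) (ℕₚ.+-monoˡ-< (m ℕ.* 8) (m%n<n L 8))
  8m≤L : m ℕ.* 8 ≤ L
  8m≤L = subst (m ℕ.* 8 ≤_) (sym L≡) (ℕₚ.m≤n+m (m ℕ.* 8) (L ℕ.% 8))
  17≤m : 17 ≤ m
  17≤m = ℕₚ.≤-pred (ℕₚ.*-cancelʳ-< 8 17 (suc m) (ℕₚ.≤-<-trans 136≤L L<8m+8))
  n≡ : n ≡ n ℕ.% 2 ℕ.+ h ℕ.* 2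
  n≡ = m≡m%n+[m/n]*n n 2
  n<2+2h : n ℕ.< 2 ℕ.+ h ℕ.* 2
  n<2+2h = subst (ℕ._< 2 ℕ.+ h ℕ.* 2) (sym n≡) (ℕₚ.+-monoˡ-< (h ℕ.* 2) (m%n<n n 2))
  2h≤n : 2 ℕ.* h ≤ n
  2h≤n = subst₂ _≤_ (ℕₚ.*-comm h 2) (sym n≡) (ℕₚ.m≤n+m (h ℕ.* 2) (n ℕ.% 2))
  10≤n : 10 ≤ n
  10≤n = ℕₚ.≤-trans (ℕₚ.≤ᵇ⇒≤ 10 (2 ℕ.^ 136) _) 2^136≤n
  5≤h : 5 ≤ h
  5≤h = ℕₚ.≤-pred (ℕₚ.*-cancelʳ-< 2 5 (suc h) (ℕₚ.≤-<-trans 10≤n n<2+2h))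
  n³≤ : n ℕ.^ 3 ≤ (2 ℕ.^ (3 ℕ.* m ℕ.+ 3)) ℕ.^ 8
  n³≤ = n^a≤2^e^b {n} {L} 3 8 (3 ℕ.* m ℕ.+ 3) (n≤2^⌈log₂n⌉ n)
    (ℕₚ.≤-trans (ℕₚ.*-monoˡ-≤ 3 (ℕₚ.<⇒≤ L<8m+8)) (ℕₚ.≤-reflexive (arith m)))
    where
    arith : ∀ m → (8 ℕ.+ m ℕ.* 8) ℕ.* 3 ≡ (3 ℕ.* m ℕ.+ 3) ℕ.* 8
    arith = solve-∀
  ≤n : 800 ℕ.* (2 ℕ.^ (3 ℕ.* m ℕ.+ 3) ℕ.* 2 ℕ.^ (3 ℕ.* m ℕ.+ 3)) ℕ.* 2 ℕ.^ m ≤ n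
  ≤n = c2^e2^e2^m≤n 10 (3 ℕ.* m ℕ.+ 3) m (ℕₚ.≤ᵇ⇒≤ 800 (2 ℕ.^ 10) _)
    (2^⌈log₂n⌉≤2n n (ℕₚ.≤-trans (ℕ.s≤s ℕ.z≤n) 10≤n)) (begin
      suc (10 ℕ.+ ((3 ℕ.* m ℕ.+ 3) ℕ.+ (3 ℕ.* m ℕ.+ 3)) ℕ.+ m)  ≡⟨ arith m ⟩
      17 ℕ.+ m ℕ.* 7                                            ≤⟨ ℕₚ.+-monoˡ-≤ (m ℕ.* 7) 17≤m ⟩
      m ℕ.+ m ℕ.* 7                                             ≡⟨ ℕₚ.*-suc m 7 ⟨
      m ℕ.* 8                                                   ≤⟨ 8m≤L ⟩
      L                                                         ∎)
    where
    arith : ∀ m → suc (10 ℕ.+ ((3 ℕ.* m ℕ.+ 3) ℕ.+ (3 ℕ.* m ℕ.+ 3)) ℕ.+ m) ≡ 17 ℕ.+ m ℕ.* 7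
    arith = solve-∀
  -- 54 = 3 · 9 · 2: the factors 3 and 9 absorb the rounding in `h` and `m`, and 2 absorbs the
  -- predecessor.
  nlogn≤ : n ℕ.* L ≤ 54 ℕ.* (ℕ.pred m ℕ.* h)
  nlogn≤ = begin
    n ℕ.* L                          ≤⟨ ℕₚ.*-mono-≤ n≤3h L≤9m ⟩
    (3 ℕ.* h) ℕ.* (9 ℕ.* m)          ≤⟨ ℕₚ.*-monoʳ-≤ (3 ℕ.* h) (ℕₚ.*-monoʳ-≤ 9 m≤2m′) ⟩
    (3 ℕ.* h) ℕ.* (9 ℕ.* (2 ℕ.* m′)) ≡⟨ arith h m′ ⟩
    54 ℕ.* (m′ ℕ.* h)                ∎
    where
    m′ : ℕ
    m′ = ℕ.pred m
    arith : ∀ h m′ → (3 ℕ.* h) ℕ.* (9 ℕ.* (2 ℕ.* m′)) ≡ 54 ℕ.* (m′ ℕ.* h)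
    arith = solve-∀
    m≡1+m′ : m ≡ suc m′
    m≡1+m′ = sym (ℕₚ.suc-pred m {{ℕ.>-nonZero (ℕₚ.≤-trans (ℕ.s≤s ℕ.z≤n) 17≤m)}})
    m≤2m′ : m ≤ 2 ℕ.* m′
    m≤2m′ = subst (_≤ 2 ℕ.* m′) (sym m≡1+m′) (ℕₚ.+-mono-≤ {1} {m′} {m′} {m′ ℕ.+ 0}
      (ℕₚ.≤-trans (ℕ.s≤s ℕ.z≤n) (ℕₚ.pred-mono-≤ 17≤m)) (ℕₚ.≤-reflexive (sym (ℕₚ.+-identityʳ m′))))
    n≤3h : n ≤ 3 ℕ.* h
    n≤3h = ℕₚ.≤-trans (ℕₚ.≤-pred n<2+2h) (ℕₚ.≤-trans (ℕₚ.+-monoˡ-≤ (h ℕ.* 2) (ℕₚ.≤-trans (ℕ.s≤s ℕ.z≤n) 5≤h))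
      (ℕₚ.≤-reflexive (trans (sym (ℕₚ.*-suc h 2)) (ℕₚ.*-comm h 3))))
    L≤9m : L ≤ 9 ℕ.* m
    L≤9m = ℕₚ.≤-trans (ℕₚ.<⇒≤ L<8m+8) (ℕₚ.≤-trans (ℕₚ.+-monoˡ-≤ (m ℕ.* 8) (ℕₚ.≤-trans (ℕₚ.m≤m+n 8 9) 17≤m))
      (ℕₚ.≤-reflexive (trans (sym (ℕₚ.*-suc m 8)) (ℕₚ.*-comm m 9))))

-- Success on a uniformly random input at a rational noise parameter

^ℚ-distrib-* : ∀ p q n → (p * q) ^ℚ n ≡ p ^ℚ n * q ^ℚ n
^ℚ-distrib-* = Exp.^-distrib-*

1^ℚ : ∀ n → 1ℚ ^ℚ n ≡ 1ℚ
1^ℚ zero    = refl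
1^ℚ (suc n) = trans (ℚₚ.*-identityˡ (1ℚ ^ℚ n)) (1^ℚ n)

½^n*2^n≡1 : ∀ n → ½ ^ℚ n * ℕtoℚ 2 ^ℚ n ≡ 1ℚ
½^n*2^n≡1 n = trans (sym (^ℚ-distrib-* ½ (ℕtoℚ 2) n)) (1^ℚ n)

uniform : ∀ n → Weights n
uniform n = replicate n (½ , ½)

uniform-pos : ∀ n → PosWeights (uniform n)
uniform-pos zero    = []
uniform-pos (suc n) = (ℚₚ.positive⁻¹ ½ , ℚₚ.positive⁻¹ ½) ∷ uniform-pos n

total-uniform : ∀ n → total (uniform n) ≡ 1ℚ
total-uniform zero    = refl
total-uniform (suc n) = cong (1ℚ *_) (total-uniform n)

balance-uniform : ∀ n → balance (uniform n) ≡ 1ℚ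
balance-uniform zero    = refl
balance-uniform (suc n) = cong (1ℚ *_) (balance-uniform n)

indicator-cases : ∀ {P : Set} (P? : Dec P) →
  (if does P? then 1ℚ else 0ℚ) ≤ℚ 0ℚ ⊎ (P × (if does P? then 1ℚ else 0ℚ) ≤ℚ 1ℚ)
indicator-cases (yes p) = inj₂ (p , ℚₚ.≤-refl)
indicator-cases (no  _) = inj₁ ℚₚ.≤-refl

-- Success at a leaf as a function of the rank alone, as `leaf-bound` requires. At `N = ℕtoℚ n` and
-- `y = ℕtoℚ (rank x)` it is `chance` of `output r` by definition.
hit : ℚ → ℚ → ℚ → ℚ
hit N r y = if does ((ℕtoℚ 40 * ℚ.∣ r - y ∣) ^ℚ 8 ℚₚ.≤? N ^ℚ 3) then 1ℚ else 0ℚ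

-- Comparing eighth powers gives 40 ∣r - y∣ ≤ T; the factor 40 then pays for the margin, as T / 40 ≤
-- T - 1 for T ≥ 2.
hit-supported : ∀ {N T} r → ℕtoℚ 2 ≤ℚ T → N ^ℚ 3 ≤ℚ T ^ℚ 8 → SupportedNear T r (hit N r)
hit-supported {N} {T} r 2≤T N³≤T⁸ y =
  map₂ (λ (close , w≤1) → w≤1 , lower (d≤T-1 close) , upper (d≤T-1 close))
    (indicator-cases ((ℕtoℚ 40 * ℚ.∣ r - y ∣) ^ℚ 8 ℚₚ.≤? N ^ℚ 3))
  where
  0≤T : 0ℚ ≤ℚ T
  0≤T = ℚₚ.≤-trans (ℚₚ.nonNegative⁻¹ (ℕtoℚ 2)) 2≤T
  40d≤T : (ℕtoℚ 40 * ℚ.∣ r - y ∣) ^ℚ 8 ≤ℚ N ^ℚ 3 → ℕtoℚ 40 * ℚ.∣ r - y ∣ ≤ℚ T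
  40d≤T close with ℕtoℚ 40 * ℚ.∣ r - y ∣ ℚₚ.≤? T
  ... | yes ≤T = ≤T
  ... | no  ≰T = contradiction (ℚₚ.≤-trans close N³≤T⁸) (<⇒≱ (^ℚ-mono-< 7 0≤T (ℚₚ.≰⇒> ≰T)))
  d≤T-1 : (ℕtoℚ 40 * ℚ.∣ r - y ∣) ^ℚ 8 ≤ℚ N ^ℚ 3 → ℚ.∣ r - y ∣ ≤ℚ T - 1ℚ
  d≤T-1 close = *-cancelˡ (ℚₚ.positive⁻¹ (ℕtoℚ 40)) (≤-from-diff
    (0≤+ (0≤- (40d≤T close)) (0≤+ (0≤* (ℚₚ.nonNegative⁻¹ (ℕtoℚ 39)) (0≤- 2≤T)) (ℚₚ.nonNegative⁻¹ (ℕtoℚ 38))))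
    (solve 2 (λ d T → con (ℕtoℚ 40) :* (T :- con 1ℚ) :- con (ℕtoℚ 40) :* d
      := (T :- con (ℕtoℚ 40) :* d) :+ (con (ℕtoℚ 39) :* (T :- con (ℕtoℚ 2)) :+ con (ℕtoℚ 38)))
      refl (ℚ.∣ r - y ∣) T))
  lower : ℚ.∣ r - y ∣ ≤ℚ T - 1ℚ → 1ℚ - T ≤ℚ y - r
  lower d≤ = ≤-from-diff (0≤- (ℚₚ.≤-trans (p≤∣p∣ (r - y)) d≤))
    (solve 3 (λ r y T → y :- r :- (con 1ℚ :- T) := T :- con 1ℚ :- (r :- y)) refl r y T)
  upper : ℚ.∣ r - y ∣ ≤ℚ T - 1ℚ → y - r ≤ℚ T - 1ℚ
  upper d≤ = ℚₚ.≤-trans (p≤∣p∣ (y - r)) (subst (_≤ℚ T - 1ℚ)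
    (trans (sym (ℚₚ.∣-p∣≡∣p∣ (r - y))) (cong ℚ.∣_∣ (solve 2 (λ r y → :- (r :- y) := y :- r) refl r y))) d≤)

noisyChannel : ∀ γ → 0ℚ ≤ℚ γ → γ <ℚ 1ℚ → Channel
noisyChannel γ 0≤γ γ<1 = record
  { α = α ; β = β ; κ₀ = κ₀ ; 0<α = 0<α ; 0<β = 0<β
  ; α+β≡1 = solve 1 (λ γ → con ½ :+ con ½ :* γ :+ (con ½ :- con ½ :* γ) := con 1ℚ) refl γ
  ; 0≤κ₀ = ℚₚ.<⇒≤ (proj₁ (proj₂ [αβ]⁻¹)) ; κ₀αβ≡1 = κ₀αβ≡1
  -- 4 α β = 1 - γ² ≤ 1 = κ₀ α β.
  ; 4≤κ₀ = *-cancelˡ 0<αβ (subst (α * β * ℕtoℚ 4 ≤ℚ_) (trans (sym κ₀αβ≡1) (ℚₚ.*-comm κ₀ (α * β)))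
      (≤-from-diff (0≤² γ)
        (solve 1 (λ γ → con 1ℚ :- (con ½ :+ con ½ :* γ) :* (con ½ :- con ½ :* γ) :* con (ℕtoℚ 4) := γ :* γ) refl γ)))
  }
  where
  α β : ℚ
  α = ½ + ½ * γ
  β = ½ - ½ * γ
  0<α : 0ℚ <ℚ α
  0<α = ℚₚ.+-mono-<-≤ (ℚₚ.positive⁻¹ ½) (0≤* (ℚₚ.nonNegative⁻¹ ½) 0≤γ)
  0<β : 0ℚ <ℚ β
  0<β = subst₂ _<ℚ_ (ℚₚ.+-inverseʳ (½ * γ)) refl
    (ℚₚ.+-monoˡ-< (- (½ * γ)) (subst (½ * γ <ℚ_) (ℚₚ.*-identityʳ ½) (ℚₚ.*-monoʳ-<-pos ½ γ<1)))
  0<αβ : 0ℚ <ℚ α * β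
  0<αβ = 0<* 0<α 0<β
  [αβ]⁻¹ : Σ ℚ λ r → 0ℚ <ℚ r × r * (α * β) ≡ 1ℚ
  [αβ]⁻¹ = inverse 0<αβ
  κ₀ : ℚ
  κ₀ = proj₁ [αβ]⁻¹
  κ₀αβ≡1 : κ₀ * (α * β) ≡ 1ℚ
  κ₀αβ≡1 = proj₂ (proj₂ [αβ]⁻¹)

module _ {n : ℕ} (S : Scale n) (γ : ℚ) (0≤γ : 0ℚ ≤ℚ γ) (γ<1 : γ <ℚ 1ℚ) where
  open Scale S
  private
    C : Channel
    C = noisyChannel γ 0≤γ γ<1
  open Channel C

  private
    E : ℕ
    E = 2 ℕ.^ (3 ℕ.* m ℕ.+ 3)
    T δ : ℚ
    T = ℕtoℚ E
    δ = ½ ^ℚ m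
    m′ : ℕ
    m′ = ℕ.pred m

    0<δ : 0ℚ <ℚ δ
    0<δ = go m
      where
      go : ∀ k → 0ℚ <ℚ ½ ^ℚ k
      go zero    = ℚₚ.positive⁻¹ 1ℚ
      go (suc k) = 0<* (ℚₚ.positive⁻¹ ½) (go k)

    2≤T : ℕtoℚ 2 ≤ℚ T
    2≤T = ℕtoℚ-mono (ℕₚ.^-monoʳ-≤ 2 {1} (ℕₚ.≤-trans (ℕₚ.m≤m+n 1 2) (ℕₚ.m≤n+m 3 (3 ℕ.* m))))

    N³≤T⁸ : ℕtoℚ n ^ℚ 3 ≤ℚ T ^ℚ 8
    N³≤T⁸ = subst₂ _≤ℚ_ (ℕtoℚ-^ n 3) (ℕtoℚ-^ E 8) (ℕtoℚ-mono n³≤)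

    800T²≤δn : ℕtoℚ 800 * (T * T) ≤ℚ δ * ℕtoℚ n
    800T²≤δn = subst (_≤ℚ δ * ℕtoℚ n)
      (trans (cong (δ *_) (trans (ℕtoℚ-* (800 ℕ.* (E ℕ.* E)) (2 ℕ.^ m))
                          (cong₂ _*_ (trans (ℕtoℚ-* 800 (E ℕ.* E)) (cong (ℕtoℚ 800 *_) (ℕtoℚ-* E E))) (ℕtoℚ-^ 2 m))))
        (trans (solve 3 (λ δ X M → δ :* (X :* M) := (δ :* M) :* X) refl δ (ℕtoℚ 800 * (T * T)) (ℕtoℚ 2 ^ℚ m))
          (sym (≡1⇒≡* (½^n*2^n≡1 m)))))
      (*-monoˡ (ℚₚ.<⇒≤ 0<δ) (ℕtoℚ-mono ≤n))

    leaf : LeafBound C (^ℚ≥0 h (ℚₚ.<⇒≤ 0<δ))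
    leaf {v} pos 0≤g g·bal≡1 r = subst (_≤ℚ _) (∫-cong v (λ x → cong (hit (ℕtoℚ n) r) (size≡rank x)))
      (leaf-bound {w = hit (ℕtoℚ n) r} h (hit-supported {ℕtoℚ n} r 2≤T N³≤T⁸) pos (ℚₚ.<-≤-trans (ℚₚ.positive⁻¹ (ℕtoℚ 2)) 2≤T)
        0<δ (^ℚ≤1 m (ℚₚ.nonNegative⁻¹ ½) (ℚₚ.<⇒≤ ½<1)) 2h≤n 800T²≤δn 0≤g g·bal≡1)
      where
      ½<1 : ½ <ℚ 1ℚ
      ½<1 = ℚₚ.+-monoʳ-< ½ (ℚₚ.positive⁻¹ ½)

    -- As κ₀ α β = 1, κ - 1 = κ₀ (1 - 4 α β), and 1 - 4 α β = γ².
    κ≡1+κ₀γ² : κ ≡ 1ℚ + κ₀ * (γ * γ)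
    κ≡1+κ₀γ² = trans (solve 1 (λ k → k :- con (ℕtoℚ 3) := k :- con (ℕtoℚ 4) :* con 1ℚ :+ con 1ℚ) refl κ₀)
      (trans (cong (λ z → κ₀ - ℕtoℚ 4 * z + 1ℚ) (sym κ₀αβ≡1))
        (solve 2 (λ k γ → k :- con (ℕtoℚ 4) :* (k :* ((con ½ :+ con ½ :* γ) :* (con ½ :- con ½ :* γ))) :+ con 1ℚ
          := con 1ℚ :+ k :* (γ :* γ)) refl κ₀ γ))

    -- The distance of γ from 1 keeps `κ₀` bounded: 4 α β = 1 - γ² ≥ 1 - γ ≥ ε / 2.
    κ₀ε≤8 : ∀ {ε} → γ ≤ℚ 1ℚ - ½ * ε → κ₀ * ε ≤ℚ ℕtoℚ 8
    κ₀ε≤8 {ε} γ≤ = ≤-from-diff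
      (0≤* (ℚₚ.nonNegative⁻¹ (ℕtoℚ 2)) (0≤* 0≤κ₀ (0≤+ (0≤- γ≤) (0≤* 0≤γ (0≤- (ℚₚ.<⇒≤ γ<1))))))
      (trans (cong (λ z → ℕtoℚ 8 * z - κ₀ * ε) (sym κ₀αβ≡1))
        (solve 3 (λ k γ ε → con (ℕtoℚ 8) :* (k :* ((con ½ :+ con ½ :* γ) :* (con ½ :- con ½ :* γ))) :- k :* ε
          := con (ℕtoℚ 2) :* (k :* ((con 1ℚ :- con ½ :* ε :- γ) :+ γ :* (con 1ℚ :- γ)))) refl κ₀ γ ε))

    k : ℕ
    k = m′ ℕ.* h

    1≤k : 1 ≤ k
    1≤k = ℕₚ.*-mono-≤ {1} {m′} {1} {h} (ℕₚ.≤-trans (ℕ.s≤s ℕ.z≤n) (ℕₚ.pred-mono-≤ 17≤m)) (ℕₚ.≤-trans (ℕ.s≤s ℕ.z≤n) 5≤h)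

    -- 864 = 2 · 8 · 54, from the leading 2, from κ₀ ε ≤ 8 and from n ⌈log₂ n⌉ ≤ 54 k.
    exponent : ∀ {ε} q → 0ℚ ≤ℚ ε → γ ≤ℚ 1ℚ - ½ * ε →
      ℕtoℚ q * (γ * γ) ≤ℚ ε * (ℤ.+ 1 / 864) * ℕtoℚ n * ℕtoℚ ⌈log₂ n ⌉ →
      ℕtoℚ 2 * (ℕtoℚ q * (κ₀ * (γ * γ))) ≤ℚ ℕtoℚ k
    exponent {ε} q 0≤ε γ≤ few = ≤-from-diff
      (0≤+ (0≤+ (0≤* (0≤* (ℚₚ.nonNegative⁻¹ (ℕtoℚ 2)) 0≤κ₀) (0≤- few))
                (0≤* (0≤* (ℚₚ.nonNegative⁻¹ (ℤ.+ 1 / 432)) (0≤* (ℕtoℚ≥0 n) (ℕtoℚ≥0 ⌈log₂ n ⌉))) (0≤- (κ₀ε≤8 γ≤))))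
           (0≤* (ℚₚ.nonNegative⁻¹ (ℤ.+ 1 / 54)) (0≤- nL≤54k)))
      (solve 7 (λ k κ₀ Q g ε N L →
        k :- con (ℕtoℚ 2) :* (Q :* (κ₀ :* g))
        := con (ℕtoℚ 2) :* κ₀ :* (ε :* con (ℤ.+ 1 / 864) :* N :* L :- Q :* g)
           :+ con (ℤ.+ 1 / 432) :* (N :* L) :* (con (ℕtoℚ 8) :- κ₀ :* ε)
           :+ con (ℤ.+ 1 / 54) :* (con (ℕtoℚ 54) :* k :- N :* L))
        refl (ℕtoℚ k) κ₀ (ℕtoℚ q) (γ * γ) ε (ℕtoℚ n) (ℕtoℚ ⌈log₂ n ⌉))
      where
      nL≤54k : ℕtoℚ n * ℕtoℚ ⌈log₂ n ⌉ ≤ℚ ℕtoℚ 54 * ℕtoℚ k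
      nL≤54k = subst₂ _≤ℚ_ (ℕtoℚ-* n ⌈log₂ n ⌉) (ℕtoℚ-* 54 k) (ℕtoℚ-mono nlogn≤)

    -- δ^h = 2^(- m h), while k = (m - 1) h falls short of m h by h; the surplus 2^(- h) is at most
    -- 2^(- 5).
    2^kδ^h≤1/32 : ℕtoℚ 2 ^ℚ k * δ ^ℚ h ≤ℚ ℤ.+ 1 / 32
    2^kδ^h≤1/32 = begin
      ℕtoℚ 2 ^ℚ k * δ ^ℚ h                    ≡⟨ cong (λ z → ℕtoℚ 2 ^ℚ k * (½ ^ℚ z) ^ℚ h) m≡1+m′ ⟩
      ℕtoℚ 2 ^ℚ k * (½ * ½ ^ℚ m′) ^ℚ h        ≡⟨ cong (ℕtoℚ 2 ^ℚ k *_) (^ℚ-distrib-* ½ (½ ^ℚ m′) h) ⟩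
      ℕtoℚ 2 ^ℚ k * (½ ^ℚ h * (½ ^ℚ m′) ^ℚ h) ≡⟨ cong (λ z → ℕtoℚ 2 ^ℚ k * (½ ^ℚ h * z)) (^ℚ-assoc ½ m′ h) ⟩
      ℕtoℚ 2 ^ℚ k * (½ ^ℚ h * ½ ^ℚ k)         ≡⟨ solve 3 (λ a b c → a :* (b :* c) := (c :* a) :* b) refl (ℕtoℚ 2 ^ℚ k) (½ ^ℚ h) (½ ^ℚ k) ⟩
      (½ ^ℚ k * ℕtoℚ 2 ^ℚ k) * ½ ^ℚ h         ≡⟨ ≡1⇒≡* (½^n*2^n≡1 k) ⟨
      ½ ^ℚ h                                  ≤⟨ ^ℚ-antimonoʳ {½} (ℚₚ.nonNegative⁻¹ ½) (ℚₚ.<⇒≤ (ℚₚ.+-monoʳ-< ½ (ℚₚ.positive⁻¹ ½))) 5≤h ⟩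
      ½ ^ℚ 5                                  ≡⟨⟩
      ℤ.+ 1 / 32                              ∎
      where
      open ℚₚ.≤-Reasoning
      m≡1+m′ : m ≡ suc m′
      m≡1+m′ = sym (ℕₚ.suc-pred m {{ℕ.>-nonZero (ℕₚ.≤-trans (ℕ.s≤s ℕ.z≤n) 17≤m)}})

  average-chance : ∀ {ε} q → 0ℚ ≤ℚ ε → γ ≤ℚ 1ℚ - ½ * ε →
    ℕtoℚ q * (γ * γ) ≤ℚ ε * (ℤ.+ 1 / 864) * ℕtoℚ n * ℕtoℚ ⌈log₂ n ⌉ →
    ∀ t → depth t ≤ q → ∫ (uniform n) (λ x → chance (½ + ½ * γ) (½ - ½ * γ) x t) ≤ℚ ℤ.+ 3 / 20
  average-chance q 0≤ε γ≤ few t depth≤q = begin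
    ∫ (uniform n) (λ x → chance α β x t)
      ≤⟨ tree-bound C (^ℚ≥0 h (ℚₚ.<⇒≤ 0<δ)) leaf q t depth≤q (uniform-pos n) (ℚₚ.nonNegative⁻¹ 1ℚ)
           (trans (ℚₚ.*-identityˡ _) (balance-uniform n)) ⟩
    ℤ.+ 1 / 10 * total (uniform n) + κ ^ℚ q * (total (uniform n) ³ * 1ℚ * δ ^ℚ h)
      ≡⟨ cong₂ (λ z u → ℤ.+ 1 / 10 * z + u ^ℚ q * (z ³ * 1ℚ * δ ^ℚ h)) (total-uniform n) κ≡1+κ₀γ² ⟩
    ℤ.+ 1 / 10 * 1ℚ + (1ℚ + κ₀ * (γ * γ)) ^ℚ q * (1ℚ ³ * 1ℚ * δ ^ℚ h)
      ≡⟨ cong (λ z → ℤ.+ 1 / 10 + (1ℚ + κ₀ * (γ * γ)) ^ℚ q * z) (ℚₚ.*-identityˡ (δ ^ℚ h)) ⟩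
    ℤ.+ 1 / 10 + (1ℚ + κ₀ * (γ * γ)) ^ℚ q * δ ^ℚ h
      ≤⟨ ℚₚ.+-monoʳ-≤ (ℤ.+ 1 / 10) (*-monoʳ (^ℚ≥0 h (ℚₚ.<⇒≤ 0<δ))
           ([1+x]^q≤2^k q k (0≤* 0≤κ₀ (0≤² γ)) 1≤k (exponent q 0≤ε γ≤ few))) ⟩
    ℤ.+ 1 / 10 + ℕtoℚ 2 ^ℚ k * δ ^ℚ h
      ≤⟨ ℚₚ.+-monoʳ-≤ (ℤ.+ 1 / 10) 2^kδ^h≤1/32 ⟩
    ℤ.+ 1 / 10 + ℤ.+ 1 / 32
      ≤⟨ ℚₚ.≤ᵇ⇒≤ _ ⟩
    ℤ.+ 3 / 20 ∎
    where open ℚₚ.≤-Reasoning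

-- From rationals to reals

Eventually : (ℕ → Set) → Set
Eventually P = ∃ λ N → ∀ i → N ≤ i → P i

eventually-× : ∀ {P Q} → Eventually P → Eventually Q → Eventually (λ i → P i × Q i)
eventually-× (M , p) (N , q) = M ℕ.⊔ N , λ i ≤i → p i (ℕₚ.m⊔n≤o⇒m≤o M N ≤i) , q i (ℕₚ.m⊔n≤o⇒n≤o M N ≤i)

eventually-map : ∀ {P Q : ℕ → Set} → (∀ i → P i → Q i) → Eventually P → Eventually Q
eventually-map f (N , p) = N , λ i ≤i → f i (p i ≤i)

-- There are finitely many inputs, so one threshold serves them all.
eventually-∀Input : ∀ {n} {P : Input n → ℕ → Set} → (∀ x → Eventually (P x)) → Eventually (λ i → ∀ x → P x i)
eventually-∀Input {zero}  h = eventually-map (λ { i p [] → p }) (h [])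
eventually-∀Input {suc n} h = eventually-map (λ { i (p , q) (true ∷ x) → p x ; i (p , q) (false ∷ x) → q x })
  (eventually-× (eventually-∀Input (λ x → h (true ∷ x))) (eventually-∀Input (λ x → h (false ∷ x))))

eventually-∀< : ∀ {P : ℕ → ℕ → Set} m → (∀ k → Eventually (P k)) → Eventually (λ i → ∀ k → k ℕ.< m → P k i)
eventually-∀< zero    h = 0 , λ _ _ _ ()
eventually-∀< {P} (suc m) h = eventually-map last (eventually-× (eventually-∀< m h) (h m))
  where
  last : ∀ i → (∀ k → k ℕ.< m → P k i) × P m i → ∀ k → k ℕ.< suc m → P k i
  last i (p , q) k k<1+m with ℕₚ.m<1+n⇒m<n∨m≡n k<1+m
  ... | inj₁ k<m  = p k k<m
  ... | inj₂ refl = q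

sumℚ : (ℕ → ℚ) → ℕ → ℚ
sumℚ f zero    = 0ℚ
sumℚ f (suc m) = sumℚ f m + f m

sumℚ-cong : ∀ {f g} m → (∀ k → f k ≡ g k) → sumℚ f m ≡ sumℚ g m
sumℚ-cong zero    h = refl
sumℚ-cong (suc m) h = cong₂ _+_ (sumℚ-cong m h) (h m)

seq-partialSum : ∀ a m j → seq (partialSum a m) j ≡ sumℚ (λ k → seq (a k) j) m
seq-partialSum a zero    j = refl
seq-partialSum a (suc m) j = cong (_+ seq (a m) j) (seq-partialSum a m j)

∫-sumℚ : ∀ {n} (v : Weights n) (u : ℕ → ℚ) (F : ℕ → Vec Bool n → ℚ) m →
  ∫ v (λ x → sumℚ (λ k → u k * F k x) m) ≡ sumℚ (λ k → u k * ∫ v (F k)) m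
∫-sumℚ v u F zero    = trans (∫-const v 0ℚ) (ℚₚ.*-zeroˡ (total v))
∫-sumℚ v u F (suc m) = trans (∫-linear v (u m) (λ x → sumℚ (λ k → u k * F k x) m) (F m))
  (cong (_+ u m * ∫ v (F m)) (∫-sumℚ v u F m))

-- The weights are rational approximations, so only u + η is nonnegative.
sumℚ-bound : ∀ {u I : ℕ → ℚ} {c η} m → 0ℚ ≤ℚ η → (∀ k → k ℕ.< m → 0ℚ ≤ℚ u k + η) →
  (∀ k → 0ℚ ≤ℚ I k) → (∀ k → I k ≤ℚ c) →
  sumℚ (λ k → u k * I k) m ≤ℚ c * (sumℚ u m + ℕtoℚ m * η)
sumℚ-bound {c = c} {η} zero 0≤η _ _ _ =
  ℚₚ.≤-reflexive (solve 2 (λ c η → con 0ℚ := c :* (con 0ℚ :+ con 0ℚ :* η)) refl c η)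
sumℚ-bound {u} {I} {c} {η} (suc m) 0≤η 0≤u+η 0≤I I≤c =
  subst (λ z → sumℚ (λ k → u k * I k) (suc m) ≤ℚ c * (sumℚ u (suc m) + z * η)) (sym (ℕtoℚ-suc m))
    (≤-from-diff
      (0≤+ (0≤+ (0≤- (sumℚ-bound m 0≤η (λ k k<m → 0≤u+η k (ℕₚ.m≤n⇒m≤1+n k<m)) 0≤I I≤c))
                (0≤* (0≤u+η m ℕₚ.≤-refl) (0≤- (I≤c m))))
           (0≤* 0≤η (0≤I m)))
      (solve 7 (λ c S m η u I X → c :* (S :+ u :+ (m :+ con 1ℚ) :* η) :- (X :+ u :* I)
        := (c :* (S :+ m :* η) :- X) :+ (u :+ η) :* (c :- I) :+ η :* I)
        refl c (sumℚ u m) (ℕtoℚ m) η (u m) (I m) (sumℚ (λ k → u k * I k) m)))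

seq-if : ∀ b x y j → seq (if b then x else y) j ≡ (if b then seq x j else seq y j)
seq-if true  x y j = refl
seq-if false x y j = refl

seq-successProbability : ∀ γ {n} (x : Input n) t j →
  seq (successProbability γ x t) j ≡ chance (½ + ½ * seq γ j) (½ - ½ * seq γ j) x t
seq-successProbability γ x (output r)  j = seq-if (does (isApproximation? x r)) 1ℝ 0ℝ j
seq-successProbability γ x (query i t) j = cong₂ _+_
  (cong₂ _*_ (seq-if (does (true ≟ᵇ lookup x i)) _ _ j) (seq-successProbability γ x (t true) j))
  (cong₂ _*_ (seq-if (does (false ≟ᵇ lookup x i)) _ _ j) (seq-successProbability γ x (t false) j))

if≥0 : ∀ {p q} b → 0ℚ ≤ℚ p → 0ℚ ≤ℚ q → 0ℚ ≤ℚ (if b then p else q)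
if≥0 true  0≤p _ = 0≤p
if≥0 false _ 0≤q = 0≤q

chance≥0 : ∀ {α β n} → 0ℚ ≤ℚ α → 0ℚ ≤ℚ β → (x : Input n) → ∀ t → 0ℚ ≤ℚ chance α β x t
chance≥0 0≤α 0≤β x (output r)  = if≥0 (does (isApproximation? x r)) (ℚₚ.nonNegative⁻¹ 1ℚ) ℚₚ.≤-refl
chance≥0 0≤α 0≤β x (query i t) = 0≤+
  (0≤* (if≥0 (does (true ≟ᵇ lookup x i)) 0≤α 0≤β) (chance≥0 0≤α 0≤β x (t true)))
  (0≤* (if≥0 (does (false ≟ᵇ lookup x i)) 0≤α 0≤β) (chance≥0 0≤α 0≤β x (t false)))

-- Averaging over inputs, as in Yao's principle. The series are cut at one `m` and every real is
-- read at one index `j`. Exchanging sum and average, the truncated success is at least 2/3 - 3/10 =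
-- 11/30, yet at most 3/20 · 11/5 = 33/100.
poor-on-average⇒¬solves : ∀ {n} γ (A : RandomizedAlgorithm n) → SolvesRank γ A →
  Eventually (λ j → (0ℚ ≤ℚ seq γ j × seq γ j <ℚ 1ℚ) ×
    (∀ k → ∫ (uniform n) (λ x → chance (½ + ½ * seq γ j) (½ - ½ * seq γ j) x (tree A k)) ≤ℚ ℤ.+ 3 / 20)) → ⊥
poor-on-average⇒¬solves {n} γ A solves poor = ≰₁ (ℚₚ.≤-trans lower upper)
  where
  tenth : ℚ
  tenth = ℤ.+ 1 / 10
  0<tenth : 0ℚ <ℚ tenth
  0<tenth = ℚₚ.positive⁻¹ tenth
  ≰₁ : ¬ ℤ.+ 11 / 30 ≤ℚ ℤ.+ 3 / 20 * (ℤ.+ 11 / 5)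
  ≰₁ = ℚₚ.≤⇒≤ᵇ

  term : Input n → ℕ → ℝ
  term x k = weight A k *ℝ successProbability γ x (tree A k)
  s : Input n → ℝ
  s x = proj₁ (solves x)

  cut : Eventually (λ m → (∀ x → s x ≤ℝ partialSum (term x) m +ℝ ℚtoℝ tenth) ×
                          partialSum (weight A) m ≤ℝ 1ℝ +ℝ ℚtoℝ tenth)
  cut = eventually-×
    (eventually-∀Input (λ x → eventually-map (λ _ → proj₂) (proj₁ (proj₂ (solves x)) tenth 0<tenth)))
    (eventually-map (λ _ → proj₁) (weight-sums A tenth 0<tenth))
  m : ℕ
  m = proj₁ cut
  -- The approximate weights may be negative by up to η. Taking η = 1 / (m + 1) keeps the total
  -- correction m η below 1, also for m = 0.
  reciprocal : Σ ℚ λ η → 0ℚ <ℚ η × η * ℕtoℚ (suc m) ≡ 1ℚ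
  reciprocal = inverse (ℚₚ.<-≤-trans (ℚₚ.positive⁻¹ 1ℚ) (ℕtoℚ-mono {1} {suc m} (ℕ.s≤s ℕ.z≤n)))
  η : ℚ
  η = proj₁ reciprocal
  0<η : 0ℚ <ℚ η
  0<η = proj₁ (proj₂ reciprocal)
  mη≤1 : ℕtoℚ m * η ≤ℚ 1ℚ
  mη≤1 = subst (ℕtoℚ m * η ≤ℚ_) (trans (ℚₚ.*-comm (ℕtoℚ (suc m)) η) (proj₂ (proj₂ reciprocal)))
    (*-monoʳ (ℚₚ.<⇒≤ 0<η) (ℕtoℚ-mono (ℕₚ.n≤1+n m)))

  ample : ∀ x → Eventually (λ j → ℤ.+ 11 / 30 ≤ℚ seq (partialSum (term x) m) j)
  ample x = eventually-map combine (eventually-×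
    (proj₂ (proj₂ (solves x)) tenth 0<tenth) (proj₁ (proj₂ cut m ℕₚ.≤-refl) x tenth 0<tenth))
    where
    combine : ∀ j → ℤ.+ 2 / 3 ≤ℚ seq (s x) j + tenth × seq (s x) j ≤ℚ seq (partialSum (term x) m) j + tenth + tenth →
      ℤ.+ 11 / 30 ≤ℚ seq (partialSum (term x) m) j
    combine j (p , q) = ≤-from-diff (0≤+ (0≤- p) (0≤- q))
      (solve 2 (λ S s → S :- con (ℤ.+ 11 / 30)
        := (s :+ con tenth :- con (ℤ.+ 2 / 3)) :+ (S :+ con tenth :+ con tenth :- s))
        refl (seq (partialSum (term x) m) j) (seq (s x) j))

  all : Eventually (λ j → ((∀ x → ℤ.+ 11 / 30 ≤ℚ seq (partialSum (term x) m) j) ×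
                           seq (partialSum (weight A) m) j ≤ℚ 1ℚ + tenth + tenth) ×
                          (∀ k → k ℕ.< m → 0ℚ ≤ℚ seq (weight A k) j + η))
  all = eventually-×
    (eventually-× (eventually-∀Input ample) (proj₂ (proj₂ cut m ℕₚ.≤-refl) tenth 0<tenth))
    (eventually-∀< m (λ k → weight≥0 A k η 0<η))

  j : ℕ
  j = proj₁ poor ℕ.⊔ proj₁ all
  poor-j = proj₂ poor j (ℕₚ.m≤m⊔n _ _)
  all-j  = proj₂ all j (ℕₚ.m≤n⊔m (proj₁ poor) _)

  α β : ℚ
  α = ½ + ½ * seq γ j
  β = ½ - ½ * seq γ j
  open Channel (noisyChannel (seq γ j) (proj₁ (proj₁ poor-j)) (proj₂ (proj₁ poor-j))) using (0<α; 0<β)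
  u : ℕ → ℚ
  u k = seq (weight A k) j
  I : ℕ → ℚ
  I k = ∫ (uniform n) (λ x → chance α β x (tree A k))

  nonNeg : NonNegWeights (uniform n)
  nonNeg = pos⇒nonNeg (uniform-pos n)

  0≤I : ∀ k → 0ℚ ≤ℚ I k
  0≤I k = subst (_≤ℚ I k) (trans (∫-const (uniform n) 0ℚ) (ℚₚ.*-zeroˡ (total (uniform n))))
    (∫-mono nonNeg (λ x → chance≥0 (ℚₚ.<⇒≤ 0<α) (ℚₚ.<⇒≤ 0<β) x (tree A k)))

  partial : ∀ x → seq (partialSum (term x) m) j ≡ sumℚ (λ k → u k * chance α β x (tree A k)) m
  partial x = trans (seq-partialSum (term x) m j)
    (sumℚ-cong m (λ k → cong (u k *_) (seq-successProbability γ x (tree A k) j)))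

  lower : ℤ.+ 11 / 30 ≤ℚ sumℚ (λ k → u k * I k) m
  lower = subst₂ _≤ℚ_
    (trans (∫-const (uniform n) (ℤ.+ 11 / 30)) (cong (ℤ.+ 11 / 30 *_) (total-uniform n)))
    (∫-sumℚ (uniform n) u (λ k x → chance α β x (tree A k)) m)
    (∫-mono nonNeg (λ x → subst (ℤ.+ 11 / 30 ≤ℚ_) (partial x) (proj₁ (proj₁ all-j) x)))

  -- 11/5 = (1 + 1/10 + 1/10) + 1: the truncated weights plus the correction m η.
  upper : sumℚ (λ k → u k * I k) m ≤ℚ ℤ.+ 3 / 20 * (ℤ.+ 11 / 5)
  upper = ℚₚ.≤-trans (sumℚ-bound m (ℚₚ.<⇒≤ 0<η) (proj₂ all-j) 0≤I (proj₂ poor-j))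
    (*-monoˡ (ℚₚ.nonNegative⁻¹ (ℤ.+ 3 / 20)) (ℚₚ.+-mono-≤
      (subst (_≤ℚ 1ℚ + tenth + tenth) (seq-partialSum (weight A) m j) (proj₂ (proj₁ all-j))) mη≤1))

theorem11 : (γ₀ : ℝ) → γ₀ <ℝ 1ℝ →
    Σ ℚ λ c → 0ℚ ℚ.< c × (Σ ℕ λ n₀ →
    (n : ℕ) → n₀ ≤ n →
    (γ : ℝ) → 0ℝ <ℝ γ → γ ≤ℝ γ₀ →
    (A : RandomizedAlgorithm n) → SolvesRank γ A →
    (q : ℕ) → QueryComplexityAtMost A q →
    ℚtoℝ c *ℝ ℕtoℝ n *ℝ ℕtoℝ ⌈log₂ n ⌉ ≤ℝ ℕtoℝ q *ℝ (γ *ℝ γ))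
theorem11 γ₀ (ε₀ , 0<ε₀ , γ₀+ε₀≤1) =
  ε₀ * (ℤ.+ 1 / 864) , 0<* 0<ε₀ (ℚₚ.positive⁻¹ (ℤ.+ 1 / 864)) , 2 ℕ.^ 136 , bound
  where

  bound : (n : ℕ) → 2 ℕ.^ 136 ≤ n → (γ : ℝ) → 0ℝ <ℝ γ → γ ≤ℝ γ₀ →
    (A : RandomizedAlgorithm n) → SolvesRank γ A → (q : ℕ) → QueryComplexityAtMost A q →
    ℚtoℝ (ε₀ * (ℤ.+ 1 / 864)) *ℝ ℕtoℝ n *ℝ ℕtoℝ ⌈log₂ n ⌉ ≤ℝ ℕtoℝ q *ℝ (γ *ℝ γ)
  bound n 2^136≤n γ (ε₁ , 0<ε₁ , ε₁≤γ) γ≤γ₀ A solves q depth≤q ε 0<ε = proj₁ close , decide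
    where
    R : ℚ
    R = ε₀ * (ℤ.+ 1 / 864) * ℕtoℚ n * ℕtoℚ ⌈log₂ n ⌉
    a : ℕ → ℚ
    a i = ℕtoℚ q * (seq γ i * seq γ i)
    close : ∃ λ N → ∀ i j → N ≤ i → N ≤ j → ℚ.∣ a i - a j ∣ ≤ℚ ε
    close = cauchy (ℕtoℝ q *ℝ (γ *ℝ γ)) ε 0<ε
    0<½ε₀ : 0ℚ <ℚ ½ * ε₀
    0<½ε₀ = 0<* (ℚₚ.positive⁻¹ ½) 0<ε₀

    -- Half of the gap `ε₀` between γ₀ and 1 is spent on comparing the approximations of γ and γ₀.
    γ-range : Eventually (λ j → 0ℚ ≤ℚ seq γ j × seq γ j ≤ℚ 1ℚ - ½ * ε₀)
    γ-range = eventually-map combine (eventually-× ε₁≤γ (eventually-× γ₀+ε₀≤1 (γ≤γ₀ (½ * ε₀) 0<½ε₀)))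
      where
      combine : ∀ j → 0ℚ + ε₁ ≤ℚ seq γ j × seq γ₀ j + ε₀ ≤ℚ 1ℚ × seq γ j ≤ℚ seq γ₀ j + ½ * ε₀ →
        0ℚ ≤ℚ seq γ j × seq γ j ≤ℚ 1ℚ - ½ * ε₀
      combine j (p , r , s) = ℚₚ.≤-trans (0≤+ ℚₚ.≤-refl (ℚₚ.<⇒≤ 0<ε₁)) p ,
        ≤-from-diff (0≤+ (0≤- r) (0≤- s))
          (solve 3 (λ g g₀ e → con 1ℚ :- con ½ :* e :- g := (con 1ℚ :- (g₀ :+ e)) :+ (g₀ :+ con ½ :* e :- g))
            refl (seq γ j) (seq γ₀ j) ε₀)

    1-½ε₀<1 : 1ℚ - ½ * ε₀ <ℚ 1ℚ
    1-½ε₀<1 = subst (1ℚ - ½ * ε₀ <ℚ_) (ℚₚ.+-identityʳ 1ℚ) (ℚₚ.+-monoʳ-< 1ℚ (ℚₚ.neg-antimono-< 0<½ε₀))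

    decide : ∀ i → proj₁ close ≤ i → R ≤ℚ a i + ε
    -- The order of ℚ is decidable, so refuting the negation suffices. A failure at the single index
    -- `i` spreads to all later ones: beyond the Cauchy threshold for ε, a j ≤ a i + ε ≤ R.
    decide i N≤i = decidable-stable (R ℚₚ.≤? a i + ε) λ few →
      poor-on-average⇒¬solves γ A solves
        (eventually-map poor (eventually-× γ-range (proj₁ close , aj≤R (ℚₚ.<⇒≤ (ℚₚ.≰⇒> few)))))
      where
      aj≤R : a i + ε ≤ℚ R → ∀ j → proj₁ close ≤ j → a j ≤ℚ R
      aj≤R few j N≤j = ℚₚ.≤-trans
        (≤-from-diff (0≤- (ℚₚ.≤-trans (p≤∣p∣ (a j - a i)) (proj₂ close j i N≤j N≤i)))
          (solve 3 (λ x y e → x :+ e :- y := e :- (y :- x)) refl (a i) (a j) ε))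
        few
      poor : ∀ j → (0ℚ ≤ℚ seq γ j × seq γ j ≤ℚ 1ℚ - ½ * ε₀) × a j ≤ℚ R → (0ℚ ≤ℚ seq γ j × seq γ j <ℚ 1ℚ) ×
        (∀ k → ∫ (uniform n) (λ x → chance (½ + ½ * seq γ j) (½ - ½ * seq γ j) x (tree A k)) ≤ℚ ℤ.+ 3 / 20)
      poor j ((0≤γ , γ≤) , aj≤R) = (0≤γ , γ<1) , λ k →
        average-chance (mkScale n 2^136≤n) (seq γ j) 0≤γ γ<1 q (ℚₚ.<⇒≤ 0<ε₀) γ≤ aj≤R (tree A k) (depth≤q k)
        where
        γ<1 : seq γ j <ℚ 1ℚ
        γ<1 = ℚₚ.≤-<-trans γ≤ 1-½ε₀<1
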